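{- Let $n\ge2$, $m\in\{1,\dots,n-1\}$, and let $p_1,\dots,p_n,q_1,\dots,q_n\ge0$ be integers. Then for every integer $t\ge0$, $$\Delta_t^{ -1}\,d_{N_1t}\cdots d_{N_mt}\;\mathbf T^m\big(\mathcal L_n(p_1t,q_1t;\dots;p_nt,q_nt;z)\big)\in\mathbb Z[z].$$
   Context: For $k\ge0$, $D_kf(u)=\frac1{k!}\frac{d^k}{du^k}f(u)$. Multiple Legendre polynomials: $\mathcal L_0(z)=1$, $\mathcal L_n(p_1,q_1;\dots;p_n,q_n;z)=z^{q_n}(1-z)^{p_n}D_{p_n+q_n}\big(z^{p_n}(1-z)^{q_n}\mathcal L_{n-1}(p_1,q_1;\dots;p_{n-1},q_{n-1};z)\big)$. $\mathbf T(P)(z)=\int_0^1\frac{P(z)-P(y)}{z-y}dy$ on $\mathbb C[z]$, $\mathbf T^m$ its $m$-fold iterate. For real $x$, $d_x$ is the least common multiple of $1,2,\dots,\lfloor x\rfloor$ (and $d_x=1$ if $x<1$). Let $K_1\ge\cdots\ge K_{n^2}$ be the numbers $p_i+q_j$ ($i,j=1,\dots,n$) in nonincreasing order, $N_1=K_1$, $N_j=\max\{K_j,K_1/j\}$ ($j=2,\dots,n$). For $\omega\in[0,1)$, $\mu(\omega)=\max_{\sigma\in\mathfrak S_n}\sum_{j=1}^n\big([(p_j+q_{\sigma(j)})\omega]-[(p_j+q_j)\omega]\big)\ge0$, $[x]$ the integer part. For an integer $t\ge0$, $\Delta_t=\prod_{s}s^{\mu(\{t/s\})}$, the product over primes $s>\sqrt{N_1t}$,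 where $\{x\}=x-[x]$ (only finitely many factors differ from $1$). -}

module Defs where

open import Data.Nat as ℕ using (ℕ; zero; suc; _∸_; _≤?_; _<?_)
open import Data.Nat.DivMod using (_/_; _%_)
open import Data.Nat.LCM using (lcm)
open import Data.Nat.Combinatorics using (_C_)
open import Data.Nat.Primality using (prime?)
open import Data.Nat.Properties using (≤-decTotalOrder)
open import Data.Integer as ℤ using (ℤ; +_)
open import Data.Rational as ℚ using (ℚ; 0ℚ; 1ℚ)
open import Data.Fin using (Fin)
open import Data.List as L using (List; []; _∷_; _++_; map; foldr; foldl; upTo; allFin; reverse; replicate; filter; zipWith; zip; concatMap; drop)
open import Data.Nat.ListAction using (sum; product)
open import Data.List.Relation.Unary.All using (All)
open import Data.Product using (_×_; _,_; Σ; proj₁; proj₂)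
open import Data.Maybe using (fromMaybe)
open import Relation.Binary.PropositionalEquality using (_≡_)
open import Relation.Nullary.Decidable using (_×-dec_)
import Data.List.Sort.InsertionSort.Base as Sort
open Sort ≤-decTotalOrder using (sort)

-- Polynomials in ℚ[z], as coefficient lists (constant term first).

Poly : Set
Poly = List ℚ

ℕ→ℚ : ℕ → ℚ
ℕ→ℚ k = (+ k) ℚ./ 1

ℤ→ℚ : ℤ → ℚ
ℤ→ℚ k = k ℚ./ 1

infixl 6 _⊕_
_⊕_ : Poly → Poly → Poly
[]       ⊕ Q        = Q
(a ∷ P)  ⊕ []       = a ∷ P
(a ∷ P)  ⊕ (b ∷ Q)  = (a ℚ.+ b) ∷ (P ⊕ Q)

scale : ℚ → Poly → Poly
scale c = map (c ℚ.*_)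

infixl 7 _⊗_
_⊗_ : Poly → Poly → Poly
[]      ⊗ Q = []
(a ∷ P) ⊗ Q = scale a Q ⊕ (0ℚ ∷ (P ⊗ Q))

zpow : ℕ → Poly
zpow a = replicate a 0ℚ ++ (1ℚ ∷ [])

omzpow : ℕ → Poly
omzpow zero    = 1ℚ ∷ []
omzpow (suc b) = (1ℚ ∷ ℚ.- 1ℚ ∷ []) ⊗ omzpow b

indexed : Poly → List (ℕ × ℚ)
indexed P = zip (upTo (L.length P)) P

-- D_k = (1/k!) d^k/dz^k :  z^i ↦ (i choose k) z^(i-k)
D : ℕ → Poly → Poly
D k P = drop k (map (λ ic → ℕ→ℚ (proj₁ ic C k) ℚ.* proj₂ ic) (indexed P))

-- T(z^i) = ∫₀¹ (z^i - y^i)/(z - y) dy = Σ_{j=0}^{i-1} z^j / (i - j)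
Tmono : ℕ → Poly
Tmono i = reverse (map (λ k → (+ 1) ℚ./ suc k) (upTo i))

T : Poly → Poly
T P = foldr (λ ic acc → scale (proj₂ ic) (Tmono (proj₁ ic)) ⊕ acc) [] (indexed P)

iterate : ℕ → (Poly → Poly) → Poly → Poly
iterate zero    f P = P
iterate (suc m) f P = f (iterate m f P)

legStep : Poly → ℕ × ℕ → Poly
legStep Lprev (p , q) =
  zpow q ⊗ omzpow p ⊗ D (p ℕ.+ q) (zpow p ⊗ omzpow q ⊗ Lprev)

MultiLegendre : List (ℕ × ℕ) → Poly
MultiLegendre = foldl legStep (1ℚ ∷ [])

params : ∀ n → (Fin n → ℕ) → (Fin n → ℕ) → ℕ → List (ℕ × ℕ)
params n p q t = map (λ i → (p i ℕ.* t , q i ℕ.* t)) (allFin n)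

-- d_k = lcm(1,…,k) (= 1 for k = 0); d_x := d_{⌊x⌋}
dlcm : ℕ → ℕ
dlcm k = foldr lcm 1 (map suc (upTo k))

Klist : ∀ n → (Fin n → ℕ) → (Fin n → ℕ) → List ℕ
Klist n p q = reverse (sort (concatMap (λ i → map (λ j → p i ℕ.+ q j) (allFin n)) (allFin n)))

-- K_j for j ≥ 1 (1-indexed); default 0 out of range (never used)
K : ∀ n → (Fin n → ℕ) → (Fin n → ℕ) → ℕ → ℕ
K n p q j = fromMaybe 0 (L.head (drop (j ∸ 1) (Klist n p q)))

-- ⌊N_j t⌋ where N₁ = K₁, N_j = max{K_j, K₁/j}:  ⌊N_j t⌋ = max(K_j t, ⌊K₁ t / j⌋)
floorNt : ∀ n → (Fin n → ℕ) → (Fin n → ℕ) → ℕ → ℕ → ℕ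
floorNt n p q t zero    = K n p q 1 ℕ.* t
floorNt n p q t (suc j) =
  ℕ._⊔_ (K n p q (suc j) ℕ.* t) ((K n p q 1 ℕ.* t) / suc j)

dprod : ∀ n → (Fin n → ℕ) → (Fin n → ℕ) → ℕ → ℕ → ℕ
dprod n p q t m = product (map (λ j → dlcm (floorNt n p q t (suc j))) (upTo m))

insertions : {A : Set} → A → List A → List (List A)
insertions x []       = (x ∷ []) ∷ []
insertions x (y ∷ ys) = (x ∷ y ∷ ys) ∷ map (y ∷_) (insertions x ys)

perms : {A : Set} → List A → List (List A)
perms []       = [] ∷ []
perms (x ∷ xs) = concatMap (insertions x) (perms xs)

-- With ω = {t/s} = (t mod s)/s :  [a ω] = ⌊ a (t mod s) / s ⌋.
-- μ({t/s}) = max_σ Σ_j [(p_j+q_{σ j})ω] − Σ_j [(p_j+q_j)ω]  (≥ 0, identity included)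
floorAω : (t s : ℕ) .{{_ : ℕ.NonZero s}} → ℕ → ℕ
floorAω t s a = (a ℕ.* (t % s)) / s

μ : ∀ n → (Fin n → ℕ) → (Fin n → ℕ) → (t s : ℕ) .{{_ : ℕ.NonZero s}} → ℕ
μ n p q t s =
  foldr ℕ._⊔_ 0
    (map (λ σ → sum (zipWith (λ i j → floorAω t s (p i ℕ.+ q j)) (allFin n) σ))
         (perms (allFin n)))
  ∸ sum (map (λ i → floorAω t s (p i ℕ.+ q i)) (allFin n))

-- Δ_t = Π_{primes s > √(N₁ t)} s^{μ({t/s})}.  Factors with s > K₁ t are 1,
-- so the product is taken over primes s with N₁ t < s² and s ≤ K₁ t.
Δ : ∀ n → (Fin n → ℕ) → (Fin n → ℕ) → ℕ → ℕ
Δ n p q t =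
  product (map (λ s → suc s ℕ.^ μ n p q t (suc s))
    ((filter (λ s → prime? (suc s) ×-dec (K n p q 1 ℕ.* t <? suc s ℕ.* suc s))
      (upTo (K n p q 1 ℕ.* t)))))

-- "Δ⁻¹ · c ∈ ℤ" for a rational c (Δ ≥ 1), and membership in Δ·ℤ[z]

DivIntBy : ℕ → ℚ → Set
DivIntBy Δ c = Σ ℤ (λ k → c ≡ ℤ→ℚ (k ℤ.* + Δ))

InDeltaZz : ℕ → Poly → Set
InDeltaZz Δ P = All (DivIntBy Δ) P

-- In the coordinate x = z / (1 - z) and after multiplication by 1 - z, a Legendre step is the diagonal
-- operator xⁱ ↦ C(i + p, p + q) xⁱ.  Hence the coefficient of z^N in ℒₙ is (-1)^N (Δ^N R)(0), where Δ is the
-- forward difference and R(i) = Πⱼ C(i + pⱼ, pⱼ + qⱼ).  On the side of R the operator T is -d/di, that is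
-- -log (1 + Δ), and it is a derivation; so Tᵐ ℒₙ is an integral combination of terms 1 / (k₁ ⋯ kₘ), where each
-- kᵢ is subtracted from the lower index of some factor of R.  If ν is a lower bound for r of the kᵢ, then either
-- r of the numbers pⱼ + qⱼ are at least ν, or one of them is at least 2ν, and then all the pᵢ + qⱼ in a row or in
-- a column are at least ν.  In both cases K_r ≥ ν, so k₁ ⋯ kₘ divides d_{K₁} ⋯ d_{Kₘ}.
-- Finally Π (pⱼ + qⱼ)! R is invariant under permutations of the q's, so a coefficient for the original
-- parameters is one for the permuted parameters times Π (pⱼ + q_{σ j})! / (pⱼ + qⱼ)!.  For a prime s with
-- s² > N₁ t the s-adic valuation of (a t)! is ⌊a t / s⌋, and the best σ gives the exponent μ({t / s}).

module Submission where

open import Defs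
open import Data.Fin using (Fin)
open import Data.Integer as ℤ using (ℤ)
import Data.Integer.Divisibility.Signed as ℤ∣
import Data.Integer.Properties as ℤ
open import Data.List as L using (List; []; _∷_; map; foldr; foldl; upTo; applyUpTo; applyDownFrom; length; zip; drop; reverse; zipWith; concatMap; allFin; filter)
open import Data.List.Membership.Propositional using (_∈_; find)
open import Data.List.Membership.Propositional.Properties using (∈-allFin; ∈-map⁺; ∈-map⁻; ∈-concatMap⁺; ∈-concatMap⁻)
import Data.List.Properties as L
open import Data.List.Relation.Binary.Permutation.Propositional as ↭ using (_↭_; refl; prep; swap; ↭-trans; ↭-sym; ↭-refl)
open import Data.List.Relation.Binary.Permutation.Propositional.Properties using (map⁺; ↭-reverse; ↭-length; All-resp-↭; ∈-resp-↭)
open import Data.List.Relation.Unary.All as All using (All; []; _∷_)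
open import Data.List.Relation.Unary.All.Properties using (all-filter)
open import Data.List.Relation.Unary.AllPairs using (AllPairs; []; _∷_)
import Data.List.Relation.Unary.AllPairs.Properties as AllPairs
open import Data.List.Relation.Unary.Any as Any using (here; there)
open import Data.List.Relation.Unary.Sorted.TotalOrder.Properties using (Sorted⇒AllPairs)
open import Data.List.Relation.Unary.Unique.Propositional using (Unique)
import Data.List.Relation.Unary.Unique.Propositional.Properties as Unique
open import Data.Maybe using (fromMaybe)
open import Data.Nat as ℕ using (ℕ; zero; suc; z≤n; s≤s; NonZero; _!; _^_; _≤_; _∸_)
open import Data.Nat.Combinatorics using (_C_; nCk+nC[k+1]≡[n+1]C[k+1])
open import Data.Nat.DivMod using (_/_; _%_)
import Data.Nat.DivMod as ℕ/
open import Data.Nat.Divisibility using (_∣_; divides; _∤_)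
import Data.Nat.Divisibility as ℕ∣
open import Data.Nat.LCM using (lcm; m∣lcm[m,n]; n∣lcm[m,n])
open import Data.Nat.ListAction using (sum; product)
open import Data.Nat.ListAction.Properties using (sum-++; sum-↭; product-↭)
open import Data.Nat.Primality using (Prime; prime?; euclidsLemma; prime⇒irreducible; prime⇒nonZero; ¬prime[1])
import Data.Nat.Properties as ℕ
import Data.List.Sort.InsertionSort.Properties ℕ.≤-decTotalOrder as Sort
import Data.Nat.Tactic.RingSolver as ℕSolver
open import Data.Product using (_×_; _,_; Σ; ∃; proj₁; proj₂)
open import Data.Rational as ℚ using (ℚ; 0ℚ; 1ℚ; _+_; _*_; _-_; -_; toℚᵘ)
open import Data.Rational.Properties
open import Data.Rational.Solver using (module +-*-Solver)
import Data.Rational.Unnormalised as ℚᵘ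
import Data.Rational.Unnormalised.Properties as ℚᵘ
open import Data.Sum using (_⊎_; inj₁; inj₂)
open import Function using (_∘_; id)
open import Relation.Binary.PropositionalEquality hiding ([_])
open import Relation.Nullary using (yes; no; contradiction)
open import Relation.Nullary.Decidable using (_×-dec_)
open +-*-Solver using (solve; _:=_; _:+_; _:*_; _:-_; :-_; con)

-- The diagonal action of a Legendre step is proved without expanding anything. The operator Θ = z
-- d/dz (1 - z) is multiplication by i in the basis of `α`. Raising p or q by one amounts, up to the
-- integer p + q + 1, to applying Θ plus a constant to the smaller step, and the binomial
-- coefficient obeys the same recurrence. For T, besides T 1 = 0, one fact suffices: its commutator
-- with Θ is -1. Hence T acts as -d/di on products of affine factors, and binomials are such
-- products up to a factorial. The obstacle is that T is an infinite sum on power series; it is cut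
-- off at a bound B, and degrees are tracked so that the cut loses nothing. The q's are exchanged in
-- R, before T is applied. As the K_j come from all sums p_i + q_j, one and the same product of d's
-- clears the denominators for every permutation. The denominators are compared with the K_j only by
-- counting, for each ν, the entries that are at least ν: this is exactly what matching two sorted
-- lists needs.

-- Integers inside ℚ

toℚᵘ-/1 : ∀ k → toℚᵘ (ℤ→ℚ k) ℚᵘ.≃ (k ℚᵘ./ 1)
toℚᵘ-/1 k = toℚᵘ-fromℚᵘ (k ℚᵘ./ 1)

ℤ→ℚ-+ : ∀ a b → ℤ→ℚ (a ℤ.+ b) ≡ ℤ→ℚ a + ℤ→ℚ b
ℤ→ℚ-+ a b = toℚᵘ-injective (begin
  toℚᵘ (ℤ→ℚ (a ℤ.+ b))               ≈⟨ toℚᵘ-/1 (a ℤ.+ b) ⟩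
  (a ℤ.+ b) ℚᵘ./ 1                    ≈⟨ ℚᵘ.*≡* (cong (ℤ._* ℤ.+ 1) (sym (cong₂ ℤ._+_ (ℤ.*-identityʳ a) (ℤ.*-identityʳ b)))) ⟩
  (a ℚᵘ./ 1) ℚᵘ.+ (b ℚᵘ./ 1)          ≈⟨ ℚᵘ.+-cong (toℚᵘ-/1 a) (toℚᵘ-/1 b) ⟨
  toℚᵘ (ℤ→ℚ a) ℚᵘ.+ toℚᵘ (ℤ→ℚ b)      ≈⟨ toℚᵘ-homo-+ (ℤ→ℚ a) (ℤ→ℚ b) ⟨
  toℚᵘ (ℤ→ℚ a + ℤ→ℚ b)                ∎)
  where open ℚᵘ.≃-Reasoning

ℤ→ℚ-* : ∀ a b → ℤ→ℚ (a ℤ.* b) ≡ ℤ→ℚ a * ℤ→ℚ b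
ℤ→ℚ-* a b = toℚᵘ-injective (begin
  toℚᵘ (ℤ→ℚ (a ℤ.* b))               ≈⟨ toℚᵘ-/1 (a ℤ.* b) ⟩
  (a ℚᵘ./ 1) ℚᵘ.* (b ℚᵘ./ 1)          ≈⟨ ℚᵘ.*-cong (toℚᵘ-/1 a) (toℚᵘ-/1 b) ⟨
  toℚᵘ (ℤ→ℚ a) ℚᵘ.* toℚᵘ (ℤ→ℚ b)      ≈⟨ toℚᵘ-homo-* (ℤ→ℚ a) (ℤ→ℚ b) ⟨
  toℚᵘ (ℤ→ℚ a * ℤ→ℚ b)                ∎)
  where open ℚᵘ.≃-Reasoning

ℤ→ℚ-neg : ∀ a → ℤ→ℚ (ℤ.- a) ≡ - ℤ→ℚ a
ℤ→ℚ-neg a = toℚᵘ-injective (begin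
  toℚᵘ (ℤ→ℚ (ℤ.- a))   ≈⟨ toℚᵘ-/1 (ℤ.- a) ⟩
  ℚᵘ.- (a ℚᵘ./ 1)      ≈⟨ ℚᵘ.-‿cong (toℚᵘ-/1 a) ⟨
  ℚᵘ.- toℚᵘ (ℤ→ℚ a)    ≈⟨ toℚᵘ-homo‿- (ℤ→ℚ a) ⟨
  toℚᵘ (- ℤ→ℚ a)       ∎)
  where open ℚᵘ.≃-Reasoning

ℤ→ℚ-injective : ∀ {a b} → ℤ→ℚ a ≡ ℤ→ℚ b → a ≡ b
ℤ→ℚ-injective {a} {b} eq with fromℚᵘ-injective {a ℚᵘ./ 1} {b ℚᵘ./ 1} eq
... | ℚᵘ.*≡* e = trans (sym (ℤ.*-identityʳ a)) (trans e (ℤ.*-identityʳ b))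

ℕ→ℚ-+ : ∀ a b → ℕ→ℚ (a ℕ.+ b) ≡ ℕ→ℚ a + ℕ→ℚ b
ℕ→ℚ-+ a b = ℤ→ℚ-+ (ℤ.+ a) (ℤ.+ b)

ℕ→ℚ-* : ∀ a b → ℕ→ℚ (a ℕ.* b) ≡ ℕ→ℚ a * ℕ→ℚ b
ℕ→ℚ-* a b = trans (cong ℤ→ℚ (ℤ.pos-* a b)) (ℤ→ℚ-* (ℤ.+ a) (ℤ.+ b))

ℕ→ℚ-suc : ∀ a → ℕ→ℚ (suc a) ≡ 1ℚ + ℕ→ℚ a
ℕ→ℚ-suc a = ℕ→ℚ-+ 1 a

recip : ℕ → ℚ
recip k = (ℤ.+ 1) ℚ./ suc k

ℕ→ℚ-*-recip : ∀ k → ℕ→ℚ (suc k) * recip k ≡ 1ℚ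
ℕ→ℚ-*-recip k = toℚᵘ-injective (begin
  toℚᵘ (ℕ→ℚ (suc k) * recip k)                 ≈⟨ toℚᵘ-homo-* (ℕ→ℚ (suc k)) (recip k) ⟩
  toℚᵘ (ℕ→ℚ (suc k)) ℚᵘ.* toℚᵘ (recip k)       ≈⟨ ℚᵘ.*-cong (toℚᵘ-/1 (ℤ.+ suc k)) (toℚᵘ-fromℚᵘ ((ℤ.+ 1) ℚᵘ./ suc k)) ⟩
  ((ℤ.+ suc k) ℚᵘ./ 1) ℚᵘ.* ((ℤ.+ 1) ℚᵘ./ suc k)   ≈⟨ ℚᵘ.*≡* (cong ℤ.+_ (cong suc (trans (ℕ.*-identityʳ (k ℕ.* 1)) (trans (ℕ.*-identityʳ k) (sym (trans (ℕ.+-identityʳ (k ℕ.+ 0)) (ℕ.+-identityʳ k))))))) ⟩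
  ℚᵘ.1ℚᵘ                                       ∎)
  where open ℚᵘ.≃-Reasoning

ℕ→ℚ-cancelˡ : ∀ k {x y} → ℕ→ℚ (suc k) * x ≡ ℕ→ℚ (suc k) * y → x ≡ y
ℕ→ℚ-cancelˡ k {x} {y} eq = trans (sym (undo x)) (trans (cong (recip k *_) eq) (undo y))
  where
  undo : ∀ z → recip k * (ℕ→ℚ (suc k) * z) ≡ z
  undo z = trans (solve 3 (λ r c z → r :* (c :* z) := (c :* r) :* z) refl (recip k) (ℕ→ℚ (suc k)) z)
             (trans (cong (_* z) (ℕ→ℚ-*-recip k)) (*-identityˡ z))

-- Recurrences of binomial coefficients

absorption : ∀ n k → suc k ℕ.* (suc n C suc k) ≡ suc n ℕ.* (n C k)
absorption zero    zero    = refl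
absorption zero    (suc k) = ℕ.*-zeroʳ k
absorption (suc n) zero    = trans (cong (ℕ._+ 0) (sym (nCk+nC[k+1]≡[n+1]C[k+1] (suc n) 0)))
  (trans (cong (λ x → suc x ℕ.+ 0) (trans (sym (ℕ.+-identityʳ _)) (absorption n 0))) (ℕ.+-identityʳ _))
absorption (suc n) (suc k) = begin
  suc (suc k) ℕ.* (suc (suc n) C suc (suc k))
    ≡⟨ cong (suc (suc k) ℕ.*_) (sym (nCk+nC[k+1]≡[n+1]C[k+1] (suc n) (suc k))) ⟩
  suc (suc k) ℕ.* ((suc n C suc k) ℕ.+ (suc n C suc (suc k)))
    ≡⟨ regroup (suc k) (suc n C suc k) (suc n C suc (suc k)) ⟩
  (suc n C suc k) ℕ.+ (suc k ℕ.* (suc n C suc k) ℕ.+ suc (suc k) ℕ.* (suc n C suc (suc k)))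
    ≡⟨ cong ((suc n C suc k) ℕ.+_) (cong₂ ℕ._+_ (absorption n k) (absorption n (suc k))) ⟩
  (suc n C suc k) ℕ.+ (suc n ℕ.* (n C k) ℕ.+ suc n ℕ.* (n C suc k))
    ≡⟨ cong ((suc n C suc k) ℕ.+_) (trans (sym (ℕ.*-distribˡ-+ (suc n) (n C k) (n C suc k)))
         (cong (suc n ℕ.*_) (nCk+nC[k+1]≡[n+1]C[k+1] n k))) ⟩
  suc (suc n) ℕ.* (suc n C suc k) ∎
  where
  open ≡-Reasoning
  regroup : ∀ k x y → suc k ℕ.* (x ℕ.+ y) ≡ x ℕ.+ (k ℕ.* x ℕ.+ suc k ℕ.* y)
  regroup = ℕSolver.solve-∀

-- The identity (k + 1) C(n, k + 1) = (n - k) C(n, k) without subtraction, so that it also covers k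
-- > n.
suc-C : ∀ n k → suc k ℕ.* (n C suc k) ℕ.+ k ℕ.* (n C k) ≡ n ℕ.* (n C k)
suc-C n k = ℕ.+-cancelˡ-≡ (n C k) _ _ (begin
  (n C k) ℕ.+ (suc k ℕ.* (n C suc k) ℕ.+ k ℕ.* (n C k))  ≡⟨ regroup k (n C k) (n C suc k) ⟩
  suc k ℕ.* ((n C k) ℕ.+ (n C suc k))  ≡⟨ cong (suc k ℕ.*_) (nCk+nC[k+1]≡[n+1]C[k+1] n k) ⟩
  suc k ℕ.* (suc n C suc k)            ≡⟨ absorption n k ⟩
  suc n ℕ.* (n C k)                    ∎)
  where
  open ≡-Reasoning
  regroup : ∀ k x y → x ℕ.+ (suc k ℕ.* y ℕ.+ k ℕ.* x) ≡ suc k ℕ.* (x ℕ.+ y)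
  regroup = ℕSolver.solve-∀

absorptionℚ : ∀ n k → ℕ→ℚ (suc k) * ℕ→ℚ (suc n C suc k) ≡ ℕ→ℚ (suc n) * ℕ→ℚ (n C k)
absorptionℚ n k = trans (sym (ℕ→ℚ-* (suc k) (suc n C suc k)))
  (trans (cong ℕ→ℚ (absorption n k)) (ℕ→ℚ-* (suc n) (n C k)))

suc-Cℚ : ∀ n k → ℕ→ℚ (suc k) * ℕ→ℚ (n C suc k) ≡ (ℕ→ℚ n - ℕ→ℚ k) * ℕ→ℚ (n C k)
suc-Cℚ n k = begin
  a                  ≡⟨ solve 2 (λ a b → a := (a :+ b) :- b) refl a b ⟩
  (a + b) - b        ≡⟨ cong (_- b) lifted ⟩
  ℕ→ℚ n * c - b      ≡⟨ solve 3 (λ n k c → n :* c :- k :* c := (n :- k) :* c) refl (ℕ→ℚ n) (ℕ→ℚ k) c ⟩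
  (ℕ→ℚ n - ℕ→ℚ k) * c ∎
  where
  open ≡-Reasoning
  c = ℕ→ℚ (n C k)
  a = ℕ→ℚ (suc k) * ℕ→ℚ (n C suc k)
  b = ℕ→ℚ k * c
  lifted : a + b ≡ ℕ→ℚ n * c
  lifted = trans (sym (cong₂ _+_ (ℕ→ℚ-* (suc k) (n C suc k)) (ℕ→ℚ-* k (n C k))))
    (trans (sym (ℕ→ℚ-+ (suc k ℕ.* (n C suc k)) (k ℕ.* (n C k)))) (trans (cong ℕ→ℚ (suc-C n k)) (ℕ→ℚ-* n (n C k))))

-- Power series operators

Seq : Set
Seq = ℕ → ℚ

infixl 6 _⊞_
infixl 7 _•_

_⊞_ : Seq → Seq → Seq
(a ⊞ b) n = a n + b n

_•_ : ℚ → Seq → Seq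
(c • a) n = c * a n

-- On generating functions `Z` is multiplication by z, `E` multiplication by 1 - z, `ϑ` is z d/dz,
-- and `Dₛ k` is the divided derivative D_k. In `Θ` the factor 1 - z acts before z d/dz.
Z : Seq → Seq
Z a zero    = 0ℚ
Z a (suc n) = a n

E : Seq → Seq
E a n = a n - Z a n

ϑ : Seq → Seq
ϑ a n = ℕ→ℚ n * a n

Θ : Seq → Seq
Θ a = ϑ (E a)

Dₛ : ℕ → Seq → Seq
Dₛ k a n = ℕ→ℚ ((n ℕ.+ k) C k) * a (n ℕ.+ k)

infixr 8 _^∘_
_^∘_ : (Seq → Seq) → ℕ → Seq → Seq
(W ^∘ zero)  a = a
(W ^∘ suc k) a = W ((W ^∘ k) a)

-- Sequences are compared pointwise, so compatibility with `≗` has to travel together with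
-- linearity.
record Linear (W : Seq → Seq) : Set where
  field
    respect : ∀ {a b} → a ≗ b → W a ≗ W b
    add  : ∀ a b → W (a ⊞ b) ≗ W a ⊞ W b
    scal : ∀ c a → W (c • a) ≗ c • W a

  sub : ∀ c a b → W (a ⊞ (- c) • b) ≗ λ n → W a n - c * W b n
  sub c a b n = trans (add a ((- c) • b) n) (cong (W a n +_)
    (trans (scal (- c) b n) (sym (neg-distribˡ-* c (W b n)))))
open Linear

id-linear : Linear id
id-linear = record { respect = id ; add = λ _ _ _ → refl ; scal = λ _ _ _ → refl }

∘-linear : ∀ {V W} → Linear V → Linear W → Linear (V ∘ W)
∘-linear {V} {W} v w = record
  { respect = respect v ∘ respect w
  ; add  = λ a b n → trans (respect v (add w a b) n) (add v (W a) (W b) n)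
  ; scal = λ c a n → trans (respect v (scal w c a) n) (scal v c (W a) n)
  }

^∘-linear : ∀ {W} → Linear W → ∀ k → Linear (W ^∘ k)
^∘-linear w zero    = id-linear
^∘-linear w (suc k) = ∘-linear w (^∘-linear w k)

Z-linear : Linear Z
Z-linear = record
  { respect = λ { a≗b zero → refl ; a≗b (suc n) → a≗b n }
  ; add  = λ { a b zero → refl ; a b (suc n) → refl }
  ; scal = λ { c a zero → sym (*-zeroʳ c) ; c a (suc n) → refl }
  }

E-linear : Linear E
E-linear = record
  { respect = λ a≗b n → cong₂ _-_ (a≗b n) (respect Z-linear a≗b n)
  ; add  = λ a b n → trans (cong (λ u → (a n + b n) - u) (add Z-linear a b n))
      (solve 4 (λ x y z w → (x :+ y) :- (z :+ w) := (x :- z) :+ (y :- w)) refl (a n) (b n) (Z a n) (Z b n))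
  ; scal = λ c a n → trans (cong (λ u → c * a n - u) (scal Z-linear c a n))
      (solve 3 (λ c x z → c :* x :- c :* z := c :* (x :- z)) refl c (a n) (Z a n))
  }

ϑ-linear : Linear ϑ
ϑ-linear = record
  { respect = λ a≗b n → cong (ℕ→ℚ n *_) (a≗b n)
  ; add  = λ a b n → *-distribˡ-+ (ℕ→ℚ n) (a n) (b n)
  ; scal = λ c a n → solve 3 (λ k c x → k :* (c :* x) := c :* (k :* x)) refl (ℕ→ℚ n) c (a n)
  }

Dₛ-linear : ∀ k → Linear (Dₛ k)
Dₛ-linear k = record
  { respect = λ a≗b n → cong (ℕ→ℚ ((n ℕ.+ k) C k) *_) (a≗b (n ℕ.+ k))
  ; add  = λ a b n → *-distribˡ-+ (ℕ→ℚ ((n ℕ.+ k) C k)) (a (n ℕ.+ k)) (b (n ℕ.+ k))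
  ; scal = λ c a n → solve 3 (λ k c x → k :* (c :* x) := c :* (k :* x)) refl (ℕ→ℚ ((n ℕ.+ k) C k)) c (a (n ℕ.+ k))
  }

^∘-comm : ∀ {V W} → Linear V → Linear W → (∀ a → V (W a) ≗ W (V a)) → ∀ k a → (V ^∘ k) (W a) ≗ W ((V ^∘ k) a)
^∘-comm v w vw zero    a n = refl
^∘-comm {V} {W} v w vw (suc k) a n = trans (respect v (^∘-comm v w vw k a) n) (vw ((V ^∘ k) a) n)

EZ-comm : ∀ a → E (Z a) ≗ Z (E a)
EZ-comm a zero    = refl
EZ-comm a (suc n) = refl

ϑZ : ∀ a n → ϑ (Z a) n ≡ Z (ϑ a) n + Z a n
ϑZ a zero    = refl
ϑZ a (suc n) = trans (cong (_* a n) (ℕ→ℚ-suc n))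
  (solve 2 (λ k x → (con 1ℚ :+ k) :* x := k :* x :+ x) refl (ℕ→ℚ n) (a n))

ϑE : ∀ a n → ϑ (E a) n ≡ E (ϑ a) n - Z a n
ϑE a n = trans
  (solve 3 (λ k x z → k :* (x :- z) := k :* x :- k :* z) refl (ℕ→ℚ n) (a n) (Z a n))
  (trans (cong (λ u → ϑ a n - u) (ϑZ a n))
    (solve 3 (λ x y z → x :- (y :+ z) := (x :- y) :- z) refl (ϑ a n) (Z (ϑ a) n) (Z a n)))

-- Product rule for (1 - z)^(p + 1). The innermost factor is kept apart so that both terms on the
-- right carry the same power p.
ϑE^ : ∀ p a n → ϑ ((E ^∘ p) (E a)) n ≡ (E ^∘ p) (E (ϑ a)) n - ℕ→ℚ (suc p) * (E ^∘ p) (Z a) n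
ϑE^ zero    a n = trans (ϑE a n) (cong (λ u → E (ϑ a) n - u) (sym (*-identityˡ (Z a n))))
ϑE^ (suc p) a n = begin
  ϑ (E V) n                             ≡⟨ ϑE V n ⟩
  E (ϑ V) n - Z V n                     ≡⟨ cong₂ _-_ (trans (respect E-linear (λ i → trans (ϑE^ p a i) (cong (A i +_) (neg-distribˡ-* c (B i)))) n)
                                                        (sub E-linear c A B n)) ZV ⟩
  (E A n - c * E B n) - E B n           ≡⟨ solve 3 (λ x c y → (x :- c :* y) :- y := x :- (con 1ℚ :+ c) :* y) refl (E A n) c (E B n) ⟩
  E A n - (1ℚ + c) * E B n              ≡⟨ cong (λ c → E A n - c * E B n) (ℕ→ℚ-suc (suc p)) ⟨
  E A n - ℕ→ℚ (suc (suc p)) * E B n     ∎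
  where
  open ≡-Reasoning
  V = (E ^∘ p) (E a)
  A = (E ^∘ p) (E (ϑ a))
  B = (E ^∘ p) (Z a)
  c = ℕ→ℚ (suc p)
  ZV : Z V n ≡ E B n
  ZV = trans (sym (^∘-comm E-linear Z-linear EZ-comm p (E a) n))
         (trans (respect (^∘-linear E-linear p) (λ i → sym (EZ-comm a i)) n)
           (^∘-comm E-linear E-linear (λ _ _ → refl) p (Z a) n))

ZE^ : ℕ → ℕ → Seq → Seq
ZE^ q p a = (Z ^∘ q) ((E ^∘ p) a)

ZE^-linear : ∀ q p → Linear (ZE^ q p)
ZE^-linear q p = ∘-linear (^∘-linear Z-linear q) (^∘-linear E-linear p)

ZE^-Z : ∀ q p a → ZE^ q p (Z a) ≗ Z (ZE^ q p a)
ZE^-Z q p a n = trans (respect (^∘-linear Z-linear q) (^∘-comm E-linear Z-linear EZ-comm p a) n)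
  (^∘-comm Z-linear Z-linear (λ _ _ → refl) q ((E ^∘ p) a) n)

ZE^-E : ∀ q p a → ZE^ q p (E a) ≗ E (ZE^ q p a)
ZE^-E q p a n = trans (respect (^∘-linear Z-linear q) (^∘-comm E-linear E-linear (λ _ _ → refl) p a) n)
  (^∘-comm Z-linear E-linear (λ a i → sym (EZ-comm a i)) q ((E ^∘ p) a) n)

-- Product rule for z^q (1 - z)^(p + 1), where one factor 1 - z is the one inside `Θ`.
ΘZE^ : ∀ q p a n → Θ (ZE^ q p a) n ≡
  (ZE^ q p (E (ϑ a)) n + ℕ→ℚ q * ZE^ q p (E a) n) - ℕ→ℚ (suc p) * ZE^ q p (Z a) n
ΘZE^ q p a n = trans (respect ϑ-linear (λ i → sym (ZE^-E q p a i)) n) (shifted q n)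
  where
  c = ℕ→ℚ (suc p)
  shifted : ∀ q n → ϑ (ZE^ q p (E a)) n ≡
    (ZE^ q p (E (ϑ a)) n + ℕ→ℚ q * ZE^ q p (E a) n) - c * ZE^ q p (Z a) n
  shifted zero n = trans (ϑE^ p a n)
    (solve 4 (λ x c y z → x :- c :* y := (x :+ con 0ℚ :* z) :- c :* y) refl
      ((E ^∘ p) (E (ϑ a)) n) c ((E ^∘ p) (Z a) n) ((E ^∘ p) (E a) n))
  shifted (suc q) zero = solve 2 (λ k c → con 0ℚ :* con 0ℚ := (con 0ℚ :+ k :* con 0ℚ) :- c :* con 0ℚ) refl (ℕ→ℚ (suc q)) c
  shifted (suc q) (suc n) = begin
    ℕ→ℚ (suc n) * Y                      ≡⟨ cong (_* Y) (ℕ→ℚ-suc n) ⟩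
    (1ℚ + ℕ→ℚ n) * Y                     ≡⟨ solve 2 (λ k y → (con 1ℚ :+ k) :* y := k :* y :+ y) refl (ℕ→ℚ n) Y ⟩
    ℕ→ℚ n * Y + Y                        ≡⟨ cong (_+ Y) (shifted q n) ⟩
    ((X + ℕ→ℚ q * Y) - c * W) + Y        ≡⟨ solve 5 (λ x k y c w → ((x :+ k :* y) :- c :* w) :+ y := (x :+ (con 1ℚ :+ k) :* y) :- c :* w)
                                              refl X (ℕ→ℚ q) Y c W ⟩
    (X + (1ℚ + ℕ→ℚ q) * Y) - c * W       ≡⟨ cong (λ k → (X + k * Y) - c * W) (ℕ→ℚ-suc q) ⟨
    (X + ℕ→ℚ (suc q) * Y) - c * W        ∎
    where
    open ≡-Reasoning
    X = ZE^ q p (E (ϑ a)) n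
    Y = ZE^ q p (E a) n
    W = ZE^ q p (Z a) n

Z-Dₛ : ∀ k a n → ℕ→ℚ (suc k) * Z (Dₛ (suc k) a) n ≡ ϑ (Dₛ k a) n
Z-Dₛ k a zero    = trans (*-zeroʳ (ℕ→ℚ (suc k))) (sym (*-zeroˡ (Dₛ k a 0)))
Z-Dₛ k a (suc n) = begin
  ℕ→ℚ (suc k) * (ℕ→ℚ ((n ℕ.+ suc k) C suc k) * a (n ℕ.+ suc k))
    ≡⟨ cong (λ m → ℕ→ℚ (suc k) * (ℕ→ℚ (m C suc k) * a m)) (ℕ.+-suc n k) ⟩
  ℕ→ℚ (suc k) * (ℕ→ℚ (m C suc k) * a m)        ≡⟨ *-assoc (ℕ→ℚ (suc k)) (ℕ→ℚ (m C suc k)) (a m) ⟨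
  ℕ→ℚ (suc k) * ℕ→ℚ (m C suc k) * a m          ≡⟨ cong (_* a m) (suc-Cℚ m k) ⟩
  (ℕ→ℚ m - ℕ→ℚ k) * ℕ→ℚ (m C k) * a m          ≡⟨ cong (λ x → (x - ℕ→ℚ k) * ℕ→ℚ (m C k) * a m) (ℕ→ℚ-+ (suc n) k) ⟩
  ((ℕ→ℚ (suc n) + ℕ→ℚ k) - ℕ→ℚ k) * ℕ→ℚ (m C k) * a m
    ≡⟨ solve 4 (λ n k c x → ((n :+ k) :- k) :* c :* x := n :* (c :* x)) refl (ℕ→ℚ (suc n)) (ℕ→ℚ k) (ℕ→ℚ (m C k)) (a m) ⟩
  ℕ→ℚ (suc n) * (ℕ→ℚ (m C k) * a m)            ∎
  where
  open ≡-Reasoning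
  m = suc n ℕ.+ k

-- The Leibniz rule D_{k+1}(z a) = z D_{k+1} a + D_k a, multiplied by k + 1 so that `Z-Dₛ` can
-- replace z D_{k+1}.
Dₛ-Z : ∀ k a n → ℕ→ℚ (suc k) * Dₛ (suc k) (Z a) n ≡ ϑ (Dₛ k a) n + ℕ→ℚ (suc k) * Dₛ k a n
Dₛ-Z k a n = begin
  ℕ→ℚ (suc k) * (ℕ→ℚ ((n ℕ.+ suc k) C suc k) * Z a (n ℕ.+ suc k))
    ≡⟨ cong (λ m → ℕ→ℚ (suc k) * (ℕ→ℚ (m C suc k) * Z a m)) (ℕ.+-suc n k) ⟩
  ℕ→ℚ (suc k) * (ℕ→ℚ (suc m C suc k) * a m)    ≡⟨ *-assoc (ℕ→ℚ (suc k)) (ℕ→ℚ (suc m C suc k)) (a m) ⟨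
  ℕ→ℚ (suc k) * ℕ→ℚ (suc m C suc k) * a m      ≡⟨ cong (_* a m) (absorptionℚ m k) ⟩
  ℕ→ℚ (suc m) * ℕ→ℚ (m C k) * a m              ≡⟨ cong (λ x → x * ℕ→ℚ (m C k) * a m) (trans (cong ℕ→ℚ (sym (ℕ.+-suc n k))) (ℕ→ℚ-+ n (suc k))) ⟩
  (ℕ→ℚ n + ℕ→ℚ (suc k)) * ℕ→ℚ (m C k) * a m
    ≡⟨ solve 4 (λ n k c x → (n :+ k) :* c :* x := n :* (c :* x) :+ k :* (c :* x)) refl (ℕ→ℚ n) (ℕ→ℚ (suc k)) (ℕ→ℚ (m C k)) (a m) ⟩
  ϑ (Dₛ k a) n + ℕ→ℚ (suc k) * Dₛ k a n        ∎
  where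
  open ≡-Reasoning
  m = n ℕ.+ k

-- Recurrences for one Legendre step

legOp : ℕ → ℕ → Seq → Seq
legOp p q a = ZE^ q p (Dₛ (p ℕ.+ q) (ZE^ p q a))

legOp-linear : ∀ p q → Linear (legOp p q)
legOp-linear p q = ∘-linear (ZE^-linear q p) (∘-linear (Dₛ-linear (p ℕ.+ q)) (ZE^-linear p q))

-- The operator form of (p + q + 1) C(i + p + 1, p + q + 1) = (i + p + 1) C(i + p, p + q), with `Θ`
-- in place of i. Both sides reduce to the same three terms by `Dₛ-Z` and `ΘZE^`.
legOp-sucˡ : ∀ p q a n → ℕ→ℚ (suc (p ℕ.+ q)) * legOp (suc p) q a n ≡
  Θ (legOp p q a) n + ℕ→ℚ (suc p) * legOp p q a n
legOp-sucˡ p q a n = begin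
  c * ZE^ q (suc p) (Dₛ (suc k) (Z X)) n
    ≡⟨ cong (c *_) (respect (^∘-linear Z-linear q) (λ i → sym (^∘-comm E-linear E-linear (λ _ _ → refl) p (Dₛ (suc k) (Z X)) i)) n) ⟩
  c * ZE^ q p (E (Dₛ (suc k) (Z X))) n       ≡⟨ scal W (ℕ→ℚ (suc k)) (Dₛ (suc k) (Z X)) n ⟨
  ZE^ q p (E (c • Dₛ (suc k) (Z X))) n       ≡⟨ respect W (Dₛ-Z k X) n ⟩
  ZE^ q p (E (ϑ Y ⊞ c • Y)) n                ≡⟨ trans (add W (ϑ Y) (c • Y) n) (cong (ZE^ q p (E (ϑ Y)) n +_) (scal W c Y n)) ⟩
  A + c * B                                  ≡⟨ cong₂ (λ c y → A + c * y) (ℕ→ℚ-+ (suc p) q) EY ⟩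
  A + (ℕ→ℚ (suc p) + ℕ→ℚ q) * (F - G)
    ≡⟨ solve 5 (λ a p q f g → a :+ (p :+ q) :* (f :- g) := ((a :+ q :* (f :- g)) :- p :* g) :+ p :* f) refl A (ℕ→ℚ (suc p)) (ℕ→ℚ q) F G ⟩
  ((A + ℕ→ℚ q * (F - G)) - ℕ→ℚ (suc p) * G) + ℕ→ℚ (suc p) * F
    ≡⟨ cong (λ y → ((A + ℕ→ℚ q * y) - ℕ→ℚ (suc p) * G) + ℕ→ℚ (suc p) * F) EY ⟨
  ((A + ℕ→ℚ q * B) - ℕ→ℚ (suc p) * G) + ℕ→ℚ (suc p) * F
    ≡⟨ cong (_+ ℕ→ℚ (suc p) * F) (ΘZE^ q p Y n) ⟨
  Θ (ZE^ q p Y) n + ℕ→ℚ (suc p) * F          ∎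
  where
  open ≡-Reasoning
  k = p ℕ.+ q
  c = ℕ→ℚ (suc k)
  X = ZE^ p q a
  Y = Dₛ k X
  W = ∘-linear (ZE^-linear q p) E-linear
  A = ZE^ q p (E (ϑ Y)) n
  B = ZE^ q p (E Y) n
  F = ZE^ q p Y n
  G = ZE^ q p (Z Y) n
  EY : B ≡ F - G
  EY = trans (ZE^-E q p Y n) (cong (λ u → F - u) (sym (ZE^-Z q p Y n)))

-- The operator form of (p + q + 1) C(i + p, p + q + 1) = (i - q) C(i + p, p + q).
legOp-sucʳ : ∀ p q a n → ℕ→ℚ (suc (p ℕ.+ q)) * legOp p (suc q) a n ≡
  Θ (legOp p q a) n - ℕ→ℚ q * legOp p q a n
legOp-sucʳ p q a n = begin
  c * Z (ZE^ q p (Dₛ (p ℕ.+ suc q) (ZE^ p (suc q) a))) n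
    ≡⟨ cong (λ k → c * Z (ZE^ q p (Dₛ k (ZE^ p (suc q) a))) n) (ℕ.+-suc p q) ⟩
  c * Z (ZE^ q p (Dₛ (suc k) (ZE^ p (suc q) a))) n
    ≡⟨ cong (c *_) (trans (respect Z-linear (respect (ZE^-linear q p) (respect (Dₛ-linear (suc k))
          (^∘-comm Z-linear E-linear (λ a i → sym (EZ-comm a i)) p ((E ^∘ q) a)))) n)
        (sym (ZE^-Z q p (Dₛ (suc k) (E X)) n))) ⟩
  c * ZE^ q p (Z (Dₛ (suc k) (E X))) n     ≡⟨ scal (ZE^-linear q p) c (Z (Dₛ (suc k) (E X))) n ⟨
  ZE^ q p (c • Z (Dₛ (suc k) (E X))) n     ≡⟨ respect (ZE^-linear q p) derive n ⟩
  ZE^ q p (E (ϑ Y) ⊞ (- c) • Z Y) n        ≡⟨ sub (ZE^-linear q p) c (E (ϑ Y)) (Z Y) n ⟩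
  A - c * G                                ≡⟨ cong (λ c → A - c * G) (ℕ→ℚ-+ (suc p) q) ⟩
  A - (ℕ→ℚ (suc p) + ℕ→ℚ q) * G
    ≡⟨ solve 5 (λ a p q f g → a :- (p :+ q) :* g := ((a :+ q :* (f :- g)) :- p :* g) :- q :* f) refl A (ℕ→ℚ (suc p)) (ℕ→ℚ q) F G ⟩
  ((A + ℕ→ℚ q * (F - G)) - ℕ→ℚ (suc p) * G) - ℕ→ℚ q * F
    ≡⟨ cong (λ y → ((A + ℕ→ℚ q * y) - ℕ→ℚ (suc p) * G) - ℕ→ℚ q * F) (trans (ZE^-E q p Y n) (cong (λ u → F - u) (sym (ZE^-Z q p Y n)))) ⟨
  ((A + ℕ→ℚ q * ZE^ q p (E Y) n) - ℕ→ℚ (suc p) * G) - ℕ→ℚ q * F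
    ≡⟨ cong (_- ℕ→ℚ q * F) (ΘZE^ q p Y n) ⟨
  Θ (ZE^ q p Y) n - ℕ→ℚ q * F              ∎
  where
  open ≡-Reasoning
  k = p ℕ.+ q
  c = ℕ→ℚ (suc k)
  X = ZE^ p q a
  Y = Dₛ k X
  A = ZE^ q p (E (ϑ Y)) n
  F = ZE^ q p Y n
  G = ZE^ q p (Z Y) n
  V = ∘-linear Z-linear (Dₛ-linear (suc k))
  -- `E X` is split as X - z X; `Z-Dₛ` treats the first term and `Dₛ-Z` the second.
  derive : c • Z (Dₛ (suc k) (E X)) ≗ E (ϑ Y) ⊞ (- c) • Z Y
  derive i = begin
    c * Z (Dₛ (suc k) (E X)) i
      ≡⟨ cong (c *_) (trans (respect V (λ j → cong (X j +_) (trans (cong -_ (sym (*-identityˡ (Z X j)))) (neg-distribˡ-* 1ℚ (Z X j)))) i) (sub V 1ℚ X (Z X) i)) ⟩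
    c * (Z (Dₛ (suc k) X) i - 1ℚ * Z (Dₛ (suc k) (Z X)) i)
      ≡⟨ solve 3 (λ c x y → c :* (x :- con 1ℚ :* y) := c :* x :- c :* y) refl c (Z (Dₛ (suc k) X) i) (Z (Dₛ (suc k) (Z X)) i) ⟩
    c * Z (Dₛ (suc k) X) i - c * Z (Dₛ (suc k) (Z X)) i
      ≡⟨ cong₂ _-_ (Z-Dₛ k X i) (trans (sym (scal Z-linear c (Dₛ (suc k) (Z X)) i))
           (trans (respect Z-linear (Dₛ-Z k X) i) (trans (add Z-linear (ϑ Y) (c • Y) i) (cong (Z (ϑ Y) i +_) (scal Z-linear c Y i))))) ⟩
    ϑ Y i - (Z (ϑ Y) i + c * Z Y i)
      ≡⟨ solve 4 (λ x y c z → x :- (y :+ c :* z) := (x :- y) :+ (:- c) :* z) refl (ϑ Y i) (Z (ϑ Y) i) c (Z Y i) ⟩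
    E (ϑ Y) i + (- c) * Z Y i  ∎

-- Polynomials as power series, and the basis diagonalising a Legendre step

coef : Poly → Seq
coef []      n       = 0ℚ
coef (a ∷ P) zero    = a
coef (a ∷ P) (suc n) = coef P n

coef-⊕ : ∀ P Q → coef (P ⊕ Q) ≗ coef P ⊞ coef Q
coef-⊕ []      Q       n       = sym (+-identityˡ (coef Q n))
coef-⊕ (a ∷ P) []      n       = sym (+-identityʳ (coef (a ∷ P) n))
coef-⊕ (a ∷ P) (b ∷ Q) zero    = refl
coef-⊕ (a ∷ P) (b ∷ Q) (suc n) = coef-⊕ P Q n

coef-scale : ∀ c P → coef (scale c P) ≗ c • coef P
coef-scale c []      n       = sym (*-zeroʳ c)
coef-scale c (a ∷ P) zero    = refl
coef-scale c (a ∷ P) (suc n) = coef-scale c P n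

coef-drop : ∀ k P n → coef (drop k P) n ≡ coef P (n ℕ.+ k)
coef-drop zero    P       n = cong (coef P) (sym (ℕ.+-identityʳ n))
coef-drop (suc k) []      n = refl
coef-drop (suc k) (a ∷ P) n = trans (coef-drop k P n) (cong (coef (a ∷ P)) (sym (ℕ.+-suc n k)))

-- The function `f` generalises the identity because passing to the tail of an indexed list shifts
-- the indices.
coef-weighted : ∀ (w : ℕ → ℚ) (f : ℕ → ℕ) P n →
  coef (map (λ ic → w (proj₁ ic) * proj₂ ic) (zip (applyUpTo f (length P)) P)) n ≡ w (f n) * coef P n
coef-weighted w f []      n       = sym (*-zeroʳ (w (f n)))
coef-weighted w f (a ∷ P) zero    = refl
coef-weighted w f (a ∷ P) (suc n) = coef-weighted w (f ∘ suc) P n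

coef-D : ∀ k P → coef (D k P) ≗ Dₛ k (coef P)
coef-D k P n = trans (coef-drop k (map (λ ic → ℕ→ℚ (proj₁ ic C k) * proj₂ ic) (indexed P)) n)
  (coef-weighted (λ i → ℕ→ℚ (i C k)) id P (n ℕ.+ k))

infixr 8 _⋆_
-- Polynomials act on series, so that the products in `legStep` become compositions of `Z` and `E`,
-- and no ring laws for coefficient lists are called for.
_⋆_ : Poly → Seq → Seq
([]      ⋆ s) n = 0ℚ
((a ∷ P) ⋆ s) n = a * s n + Z (P ⋆ s) n

⋆-cong : ∀ P {s u} → s ≗ u → P ⋆ s ≗ P ⋆ u
⋆-cong []      s≗u n = refl
⋆-cong (a ∷ P) s≗u n = cong₂ _+_ (cong (a *_) (s≗u n)) (respect Z-linear (⋆-cong P s≗u) n)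

coef-⊗ : ∀ P Q → coef (P ⊗ Q) ≗ P ⋆ coef Q
coef-⊗ []      Q n = refl
coef-⊗ (a ∷ P) Q n = trans (coef-⊕ (scale a Q) (0ℚ ∷ (P ⊗ Q)) n) (cong₂ _+_ (coef-scale a Q n) (shift n))
  where
  shift : coef (0ℚ ∷ (P ⊗ Q)) ≗ Z (P ⋆ coef Q)
  shift zero    = refl
  shift (suc n) = coef-⊗ P Q n

⋆-⊕ : ∀ P Q s → (P ⊕ Q) ⋆ s ≗ P ⋆ s ⊞ Q ⋆ s
⋆-⊕ []      Q       s n = sym (+-identityˡ ((Q ⋆ s) n))
⋆-⊕ (a ∷ P) []      s n = sym (+-identityʳ (((a ∷ P) ⋆ s) n))
⋆-⊕ (a ∷ P) (b ∷ Q) s n = trans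
  (cong ((a + b) * s n +_) (trans (respect Z-linear (⋆-⊕ P Q s) n) (add Z-linear (P ⋆ s) (Q ⋆ s) n)))
  (solve 5 (λ a b x y z → (a :+ b) :* x :+ (y :+ z) := (a :* x :+ y) :+ (b :* x :+ z)) refl
    a b (s n) (Z (P ⋆ s) n) (Z (Q ⋆ s) n))

⋆-scale : ∀ c P s → scale c P ⋆ s ≗ c • P ⋆ s
⋆-scale c []      s n = sym (*-zeroʳ c)
⋆-scale c (a ∷ P) s n = trans
  (cong (c * a * s n +_) (trans (respect Z-linear (⋆-scale c P s) n) (scal Z-linear c (P ⋆ s) n)))
  (solve 4 (λ c a x y → c :* a :* x :+ c :* y := c :* (a :* x :+ y)) refl c a (s n) (Z (P ⋆ s) n))

⋆-⊗ : ∀ P Q s → (P ⊗ Q) ⋆ s ≗ P ⋆ Q ⋆ s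
⋆-⊗ []      Q s n = refl
⋆-⊗ (a ∷ P) Q s n = trans (⋆-⊕ (scale a Q) (0ℚ ∷ (P ⊗ Q)) s n) (cong₂ _+_ (⋆-scale a Q s n)
  (trans (cong (_+ Z ((P ⊗ Q) ⋆ s) n) (*-zeroˡ (s n)))
    (trans (+-identityˡ _) (respect Z-linear (⋆-⊗ P Q s) n))))

one-⋆ : ∀ s → (1ℚ ∷ []) ⋆ s ≗ s
one-⋆ s zero    = trans (+-identityʳ _) (*-identityˡ (s 0))
one-⋆ s (suc n) = trans (+-identityʳ _) (*-identityˡ (s (suc n)))

zpow-⋆ : ∀ q s → zpow q ⋆ s ≗ (Z ^∘ q) s
zpow-⋆ zero    s n = one-⋆ s n
zpow-⋆ (suc q) s n = trans (cong₂ _+_ (*-zeroˡ (s n)) (respect Z-linear (zpow-⋆ q s) n)) (+-identityˡ _)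

omzpow-⋆ : ∀ p s → omzpow p ⋆ s ≗ (E ^∘ p) s
omzpow-⋆ zero    s n = one-⋆ s n
omzpow-⋆ (suc p) s n = trans (⋆-⊗ (1ℚ ∷ - 1ℚ ∷ []) (omzpow p) s n)
  (trans (cong (1ℚ * u n +_) (respect Z-linear minus n)) (trans (cong (1ℚ * u n +_) (scal Z-linear (- 1ℚ) u n))
    (trans (solve 2 (λ x y → con 1ℚ :* x :+ (:- con 1ℚ) :* y := x :- y) refl (u n) (Z u n)) (respect E-linear (omzpow-⋆ p s) n))))
  where
  u = omzpow p ⋆ s
  minus : (- 1ℚ ∷ []) ⋆ u ≗ (- 1ℚ) • u
  minus zero    = +-identityʳ _
  minus (suc n) = +-identityʳ _

pows-⊗ : ∀ q p P → coef (zpow q ⊗ omzpow p ⊗ P) ≗ ZE^ q p (coef P)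
pows-⊗ q p P n = trans (coef-⊗ (zpow q ⊗ omzpow p) P n) (trans (⋆-⊗ (zpow q) (omzpow p) (coef P) n)
  (trans (zpow-⋆ q (omzpow p ⋆ coef P) n) (respect (^∘-linear Z-linear q) (omzpow-⋆ p (coef P)) n)))

coef-legStep : ∀ P p q → coef (legStep P (p , q)) ≗ legOp p q (coef P)
coef-legStep P p q n = trans (pows-⊗ q p (D (p ℕ.+ q) Q) n) (respect (ZE^-linear q p)
  (λ i → trans (coef-D (p ℕ.+ q) Q i) (respect (Dₛ-linear (p ℕ.+ q)) (pows-⊗ p q P) i)) n)
  where Q = zpow p ⊗ omzpow q ⊗ P

-- α r is the coefficient sequence of Σᵢ (-1)ⁱ rᵢ zⁱ (1 - z)^(-i-1).
∇ : Seq → Seq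
∇ r i = r i - r (suc i)

α : Seq → Seq
α r zero    = r 0
α r (suc n) = α (∇ r) n

∇-linear : Linear ∇
∇-linear = record
  { respect = λ a≗b i → cong₂ _-_ (a≗b i) (a≗b (suc i))
  ; add  = λ a b i → solve 4 (λ x y z w → (x :+ y) :- (z :+ w) := (x :- z) :+ (y :- w)) refl (a i) (b i) (a (suc i)) (b (suc i))
  ; scal = λ c a i → solve 3 (λ c x y → c :* x :- c :* y := c :* (x :- y)) refl c (a i) (a (suc i))
  }

α-linear : Linear α
α-linear = record { respect = respect′ ; add = add′ ; scal = scal′ }
  where
  respect′ : ∀ {a b} → a ≗ b → α a ≗ α b
  respect′ a≗b zero    = a≗b 0
  respect′ a≗b (suc n) = respect′ (respect ∇-linear a≗b) n
  add′ : ∀ a b → α (a ⊞ b) ≗ α a ⊞ α b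
  add′ a b zero    = refl
  add′ a b (suc n) = trans (respect′ (add ∇-linear a b) n) (add′ (∇ a) (∇ b) n)
  scal′ : ∀ c a → α (c • a) ≗ c • α a
  scal′ c a zero    = refl
  scal′ c a (suc n) = trans (respect′ (scal ∇-linear c a) n) (scal′ c (∇ a) n)

-- With x = z / (1 - z) the basis functions are x^i / (1 - z). Multiplication by 1 - z leaves x^i,
-- and z d/dz x^i = i x^i / (1 - z). The induction on n rests on the product rule of `∇` for i r(i).
Θα : ∀ r → Θ (α r) ≗ α (λ i → ℕ→ℚ i * r i)
Θα r zero    = trans (*-zeroˡ (r 0 - 0ℚ)) (sym (*-zeroˡ (r 0)))
Θα r (suc n) = begin
  ℕ→ℚ (suc n) * (α (∇ r) n - α r n)                     ≡⟨ cong (_* (α (∇ r) n - α r n)) (ℕ→ℚ-suc n) ⟩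
  (1ℚ + ℕ→ℚ n) * (α (∇ r) n - α r n)
    ≡⟨ solve 3 (λ k x y → (con 1ℚ :+ k) :* (x :- y) := (k :* x :- k :* y) :+ (x :- con 1ℚ :* y)) refl (ℕ→ℚ n) (α (∇ r) n) (α r n) ⟩
  (ℕ→ℚ n * α (∇ r) n - ℕ→ℚ n * α r n) + (α (∇ r) n - 1ℚ * α r n)
    ≡⟨ cong (λ y → (ℕ→ℚ n * α (∇ r) n - y) + (α (∇ r) n - 1ℚ * α r n)) (shift n) ⟩
  (ℕ→ℚ n * α (∇ r) n - ℕ→ℚ n * Z (α (∇ r)) n) + (α (∇ r) n - 1ℚ * α r n)
    ≡⟨ cong (_+ (α (∇ r) n - 1ℚ * α r n)) (solve 3 (λ k x y → k :* x :- k :* y := k :* (x :- y)) refl (ℕ→ℚ n) (α (∇ r) n) (Z (α (∇ r)) n)) ⟩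
  Θ (α (∇ r)) n + (α (∇ r) n - 1ℚ * α r n)               ≡⟨ cong₂ _+_ (Θα (∇ r) n) (sym (sub α-linear 1ℚ (∇ r) r n)) ⟩
  α (λ i → ℕ→ℚ i * ∇ r i) n + α (∇ r ⊞ (- 1ℚ) • r) n      ≡⟨ add α-linear (λ i → ℕ→ℚ i * ∇ r i) (∇ r ⊞ (- 1ℚ) • r) n ⟨
  α ((λ i → ℕ→ℚ i * ∇ r i) ⊞ (∇ r ⊞ (- 1ℚ) • r)) n        ≡⟨ respect α-linear product-rule n ⟩
  α (∇ (λ i → ℕ→ℚ i * r i)) n                            ∎
  where
  open ≡-Reasoning
  -- The two sequences differ only at n = 0, where the factor n vanishes.
  shift : ∀ n → ℕ→ℚ n * α r n ≡ ℕ→ℚ n * Z (α (∇ r)) n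
  shift zero    = trans (*-zeroˡ (r 0)) (sym (*-zeroˡ 0ℚ))
  shift (suc n) = refl
  product-rule : (λ i → ℕ→ℚ i * ∇ r i) ⊞ (∇ r ⊞ (- 1ℚ) • r) ≗ ∇ (λ i → ℕ→ℚ i * r i)
  product-rule i = trans
    (solve 3 (λ k x y → k :* (x :- y) :+ ((x :- y) :+ (:- con 1ℚ) :* x) := k :* x :- (con 1ℚ :+ k) :* y) refl (ℕ→ℚ i) (r i) (r (suc i)))
    (cong (λ k → ℕ→ℚ i * r i - k * r (suc i)) (sym (ℕ→ℚ-suc i)))

-- The initial polynomial 1 is an alternating geometric series in x = z / (1 - z), because 1 / (1 +
-- x) = 1 - z.
α-const : α (λ _ → 1ℚ) ≗ coef (1ℚ ∷ [])
α-const zero    = refl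
α-const (suc n) = trans (respect α-linear {b = 0ℚ • (λ _ → 0ℚ)} (λ _ → refl) n)
  (trans (scal α-linear 0ℚ (λ _ → 0ℚ) n) (*-zeroˡ (α (λ _ → 0ℚ) n)))

-- Binomials as eigenvalues of a Legendre step

binom : ℕ → ℕ → Seq
binom p M i = ℕ→ℚ ((i ℕ.+ p) C M)

infixl 7 _⊠_
_⊠_ : Seq → Seq → Seq
(r ⊠ s) i = r i * s i

binom-sucˡ : ∀ p M i → ℕ→ℚ (suc M) * binom (suc p) (suc M) i ≡ (ℕ→ℚ i + ℕ→ℚ (suc p)) * binom p M i
binom-sucˡ p M i = begin
  ℕ→ℚ (suc M) * ℕ→ℚ ((i ℕ.+ suc p) C suc M)    ≡⟨ cong (λ y → ℕ→ℚ (suc M) * ℕ→ℚ (y C suc M)) (ℕ.+-suc i p) ⟩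
  ℕ→ℚ (suc M) * ℕ→ℚ (suc (i ℕ.+ p) C suc M)    ≡⟨ absorptionℚ (i ℕ.+ p) M ⟩
  ℕ→ℚ (suc (i ℕ.+ p)) * binom p M i            ≡⟨ cong (_* binom p M i) (trans (cong ℕ→ℚ (sym (ℕ.+-suc i p))) (ℕ→ℚ-+ i (suc p))) ⟩
  (ℕ→ℚ i + ℕ→ℚ (suc p)) * binom p M i          ∎
  where open ≡-Reasoning

binom-sucʳ : ∀ p M i → ℕ→ℚ (suc M) * binom p (suc M) i ≡ (ℕ→ℚ i + (ℕ→ℚ p - ℕ→ℚ M)) * binom p M i
binom-sucʳ p M i = trans (suc-Cℚ (i ℕ.+ p) M) (cong (_* binom p M i)
  (trans (cong (_- ℕ→ℚ M) (ℕ→ℚ-+ i p)) (+-assoc (ℕ→ℚ i) (ℕ→ℚ p) (- ℕ→ℚ M))))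

Θα-affine : ∀ c r n → Θ (α r) n + c * α r n ≡ α (λ i → (ℕ→ℚ i + c) * r i) n
Θα-affine c r n = trans (cong₂ _+_ (Θα r n) (sym (scal α-linear c r n)))
  (trans (sym (add α-linear (λ i → ℕ→ℚ i * r i) (c • r) n))
    (respect α-linear (λ i → sym (*-distribʳ-+ (r i) (ℕ→ℚ i) c)) n))

-- Induction on q at p = 0, then on p. In each step the recurrence of the operator and that of the
-- binomial have the same affine factor in i and the same positive integer, which is cancelled.
legOp-α : ∀ p q r → legOp p q (α r) ≗ α (binom p (p ℕ.+ q) ⊠ r)
legOp-α zero    zero    r n = trans (*-identityˡ _) (trans (cong (α r) (ℕ.+-identityʳ n))
  (respect α-linear (λ i → sym (*-identityˡ (r i))) n))
legOp-α zero    (suc q) r n = ℕ→ℚ-cancelˡ q (begin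
  ℕ→ℚ (suc q) * legOp 0 (suc q) (α r) n                 ≡⟨ legOp-sucʳ 0 q (α r) n ⟩
  Θ (legOp 0 q (α r)) n - ℕ→ℚ q * legOp 0 q (α r) n
    ≡⟨ cong₂ (λ x y → x - ℕ→ℚ q * y) (respect (∘-linear ϑ-linear E-linear) (legOp-α 0 q r) n) (legOp-α 0 q r n) ⟩
  Θ (α s) n - ℕ→ℚ q * α s n                             ≡⟨ solve 3 (λ x k y → x :- k :* y := x :+ (con 0ℚ :- k) :* y) refl (Θ (α s) n) (ℕ→ℚ q) (α s n) ⟩
  Θ (α s) n + (0ℚ - ℕ→ℚ q) * α s n                      ≡⟨ Θα-affine (0ℚ - ℕ→ℚ q) s n ⟩
  α (λ i → (ℕ→ℚ i + (0ℚ - ℕ→ℚ q)) * s i) n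
    ≡⟨ respect α-linear (λ i → trans (sym (*-assoc (ℕ→ℚ i + (0ℚ - ℕ→ℚ q)) (binom 0 q i) (r i)))
         (trans (cong (_* r i) (sym (binom-sucʳ 0 q i))) (*-assoc (ℕ→ℚ (suc q)) (binom 0 (suc q) i) (r i)))) n ⟩
  α (ℕ→ℚ (suc q) • (binom 0 (suc q) ⊠ r)) n             ≡⟨ scal α-linear (ℕ→ℚ (suc q)) (binom 0 (suc q) ⊠ r) n ⟩
  ℕ→ℚ (suc q) * α (binom 0 (suc q) ⊠ r) n               ∎)
  where
  open ≡-Reasoning
  s = binom 0 q ⊠ r
legOp-α (suc p) q       r n = ℕ→ℚ-cancelˡ (p ℕ.+ q) (begin
  c * legOp (suc p) q (α r) n                           ≡⟨ legOp-sucˡ p q (α r) n ⟩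
  Θ (legOp p q (α r)) n + ℕ→ℚ (suc p) * legOp p q (α r) n
    ≡⟨ cong₂ (λ x y → x + ℕ→ℚ (suc p) * y) (respect (∘-linear ϑ-linear E-linear) (legOp-α p q r) n) (legOp-α p q r n) ⟩
  Θ (α s) n + ℕ→ℚ (suc p) * α s n                       ≡⟨ Θα-affine (ℕ→ℚ (suc p)) s n ⟩
  α (λ i → (ℕ→ℚ i + ℕ→ℚ (suc p)) * s i) n
    ≡⟨ respect α-linear (λ i → trans (sym (*-assoc (ℕ→ℚ i + ℕ→ℚ (suc p)) (binom p (p ℕ.+ q) i) (r i)))
         (trans (cong (_* r i) (sym (binom-sucˡ p (p ℕ.+ q) i))) (*-assoc c (binom (suc p) (suc (p ℕ.+ q)) i) (r i)))) n ⟩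
  α (c • (binom (suc p) (suc (p ℕ.+ q)) ⊠ r)) n         ≡⟨ scal α-linear c (binom (suc p) (suc (p ℕ.+ q)) ⊠ r) n ⟩
  c * α (binom (suc p) (suc p ℕ.+ q) ⊠ r) n             ∎)
  where
  open ≡-Reasoning
  c = ℕ→ℚ (suc (p ℕ.+ q))
  s = binom p (p ℕ.+ q) ⊠ r

-- The state (p , M) stands for the factor C(x + p, M).
binoms : List (ℕ × ℕ) → Seq
binoms []            i = 1ℚ
binoms ((p , M) ∷ s) i = binom p M i * binoms s i

legState : List (ℕ × ℕ) → List (ℕ × ℕ)
legState = map (λ pq → proj₁ pq , proj₁ pq ℕ.+ proj₂ pq)

coef-MultiLegendre : ∀ ps → coef (MultiLegendre ps) ≗ α (binoms (legState ps))
coef-MultiLegendre ps n = trans (from ps (1ℚ ∷ []) (λ _ → 1ℚ) (λ i → sym (α-const i)) n)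
  (respect α-linear (λ i → *-identityʳ _) n)
  where
  from : ∀ ps P r → coef P ≗ α r → coef (foldl legStep P ps) ≗ α (binoms (legState ps) ⊠ r)
  from []             P r eq n = trans (eq n) (respect α-linear (λ i → sym (*-identityˡ (r i))) n)
  from ((p , q) ∷ ps) P r eq n = trans
    (from ps (legStep P (p , q)) (binom p (p ℕ.+ q) ⊠ r)
      (λ i → trans (coef-legStep P p q i) (trans (respect (legOp-linear p q) eq i) (legOp-α p q r i))) n)
    (respect α-linear (λ i → solve 3 (λ x y z → x :* (y :* z) := (y :* x) :* z) refl (binoms (legState ps) i) (binom p (p ℕ.+ q) i) (r i)) n)

-- The operator T as a derivation

sumTo : ℕ → Seq → ℚ
sumTo zero    f = 0ℚ
sumTo (suc n) f = f 0 + sumTo n (f ∘ suc)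

sumTo-cong : ∀ n {f g} → f ≗ g → sumTo n f ≡ sumTo n g
sumTo-cong zero    f≗g = refl
sumTo-cong (suc n) f≗g = cong₂ _+_ (f≗g 0) (sumTo-cong n (f≗g ∘ suc))

sumTo-zero : ∀ n {f} → f ≗ (λ _ → 0ℚ) → sumTo n f ≡ 0ℚ
sumTo-zero zero    f≗0 = refl
sumTo-zero (suc n) f≗0 = trans (cong₂ _+_ (f≗0 0) (sumTo-zero n (f≗0 ∘ suc))) (+-identityˡ 0ℚ)

sumTo-⊞ : ∀ n f g → sumTo n (f ⊞ g) ≡ sumTo n f + sumTo n g
sumTo-⊞ zero    f g = refl
sumTo-⊞ (suc n) f g = trans (cong ((f 0 + g 0) +_) (sumTo-⊞ n (f ∘ suc) (g ∘ suc)))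
  (solve 4 (λ x y z w → (x :+ y) :+ (z :+ w) := (x :+ z) :+ (y :+ w)) refl (f 0) (g 0) (sumTo n (f ∘ suc)) (sumTo n (g ∘ suc)))

sumTo-• : ∀ n c f → sumTo n (c • f) ≡ c * sumTo n f
sumTo-• zero    c f = sym (*-zeroʳ c)
sumTo-• (suc n) c f = trans (cong (c * f 0 +_) (sumTo-• n c (f ∘ suc))) (sym (*-distribˡ-+ c (f 0) (sumTo n (f ∘ suc))))

sumTo-telescope : ∀ n (f : Seq) → sumTo n (λ k → f (suc k) - f k) ≡ f n - f 0
sumTo-telescope zero    f = sym (+-inverseʳ (f 0))
sumTo-telescope (suc n) f = trans (cong ((f 1 - f 0) +_) (sumTo-telescope n (f ∘ suc)))
  (solve 3 (λ x y z → (x :- y) :+ (z :- x) := z :- y) refl (f 1) (f 0) (f (suc n)))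

-- T truncated after B terms; it agrees with T on polynomials of degree at most B.
Tₛ : ℕ → Seq → Seq
Tₛ B a j = sumTo B (λ k → a (suc (j ℕ.+ k)) * recip k)

Tₛ-linear : ∀ B → Linear (Tₛ B)
Tₛ-linear B = record
  { respect = λ a≗b j → sumTo-cong B (λ k → cong (_* recip k) (a≗b (suc (j ℕ.+ k))))
  ; add  = λ a b j → trans (sumTo-cong B (λ k → *-distribʳ-+ (recip k) (a (suc (j ℕ.+ k))) (b (suc (j ℕ.+ k))))) (sumTo-⊞ B _ _)
  ; scal = λ c a j → trans (sumTo-cong B (λ k → *-assoc c (a (suc (j ℕ.+ k))) (recip k))) (sumTo-• B c _)
  }

Tmono≡ : ∀ i → Tmono i ≡ applyDownFrom recip i
Tmono≡ i = trans (cong reverse (L.map-upTo recip i)) (L.reverse-applyUpTo recip i)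

coef-foldr-T : ∀ (f : ℕ → ℕ) P {N} → length P ℕ.≤ N → ∀ j →
  coef (foldr (λ ic acc → scale (proj₂ ic) (Tmono (proj₁ ic)) ⊕ acc) [] (zip (applyUpTo f (length P)) P)) j
  ≡ sumTo N (λ i → coef P i * coef (applyDownFrom recip (f i)) j)
coef-foldr-T f []      {N}     z≤n     j = sym (sumTo-zero N (λ i → *-zeroˡ (coef (applyDownFrom recip (f i)) j)))
coef-foldr-T f (a ∷ P) {suc N} (s≤s ≤N) j = trans (coef-⊕ (scale a (Tmono (f 0))) _ j)
  (cong₂ _+_ (trans (coef-scale a (Tmono (f 0)) j) (cong (λ Q → a * coef Q j) (Tmono≡ (f 0)))) (coef-foldr-T (f ∘ suc) P ≤N j))

-- The coefficient of z^j in T(z^i) is 1 / (i - j) for i > j and 0 otherwise. So the first j + 1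
-- terms vanish and B terms remain.
sumTo-applyDownFrom : ∀ j B a → sumTo (suc j ℕ.+ B) (λ i → a i * coef (applyDownFrom recip i) j) ≡ Tₛ B a j
sumTo-applyDownFrom zero    B a = trans (cong (_+ Tₛ B a 0) (*-zeroʳ (a 0))) (+-identityˡ _)
sumTo-applyDownFrom (suc j) B a = trans (cong (_+ sumTo (suc j ℕ.+ B) (λ i → a (suc i) * coef (applyDownFrom recip i) j)) (*-zeroʳ (a 0)))
  (trans (+-identityˡ _) (sumTo-applyDownFrom j B (a ∘ suc)))

coef-T : ∀ {B} P → length P ℕ.≤ B → coef (T P) ≗ Tₛ B (coef P)
coef-T {B} P P≤B j = trans (coef-foldr-T id P (ℕ.≤-trans P≤B (ℕ.m≤n+m B (suc j))) j) (sumTo-applyDownFrom j B (coef P))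

length-⊕ : ∀ {B} P Q → length P ℕ.≤ B → length Q ℕ.≤ B → length (P ⊕ Q) ℕ.≤ B
length-⊕ []      Q       P≤B       Q≤B       = Q≤B
length-⊕ (a ∷ P) []      P≤B       Q≤B       = P≤B
length-⊕ (a ∷ P) (b ∷ Q) (s≤s P≤B) (s≤s Q≤B) = s≤s (length-⊕ P Q P≤B Q≤B)

-- Ensures that a single truncation B serves all iterates of `T`.
length-T : ∀ {B} P → length P ℕ.≤ B → length (T P) ℕ.≤ B
length-T {B} P P≤B = from id P (λ i i<P → ℕ.≤-trans (ℕ.<⇒≤ i<P) P≤B)
  where
  from : ∀ (f : ℕ → ℕ) P → (∀ i → i ℕ.< length P → f i ℕ.≤ B) →
    length (foldr (λ ic acc → scale (proj₂ ic) (Tmono (proj₁ ic)) ⊕ acc) [] (zip (applyUpTo f (length P)) P)) ℕ.≤ B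
  from f []      f≤B = z≤n
  from f (a ∷ P) f≤B = length-⊕ (scale a (Tmono (f 0))) _
    (subst (ℕ._≤ B) (sym (trans (L.length-map (a *_) (Tmono (f 0))) (trans (cong length (Tmono≡ (f 0))) (L.length-applyDownFrom recip (f 0))))) (f≤B 0 (s≤s z≤n)))
    (from (f ∘ suc) P (λ i i<P → f≤B (suc i) (s≤s i<P)))

coef-iterate-T : ∀ {B} m P → length P ℕ.≤ B → coef (iterate m T P) ≗ (Tₛ B ^∘ m) (coef P)
coef-iterate-T     zero    P P≤B j = refl
coef-iterate-T {B} (suc m) P P≤B j = trans (coef-T (iterate m T P) (bounded m) j) (respect (Tₛ-linear B) (coef-iterate-T m P P≤B) j)
  where
  bounded : ∀ m → length (iterate m T P) ℕ.≤ B
  bounded zero    = P≤B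
  bounded (suc m) = length-T (iterate m T P) (bounded m)

-- Degree bounds and the Leibniz rule

Supp : ℕ → Seq → Set
Supp d a = ∀ n → d ℕ.≤ n → a n ≡ 0ℚ

Supp-mono : ∀ {d e a} → d ℕ.≤ e → Supp d a → Supp e a
Supp-mono d≤e supp n e≤n = supp n (ℕ.≤-trans d≤e e≤n)

-- T lowers degrees while Θ = z d/dz (1 - z) raises them; in the basis α they become -d/dx and multiplication by x.
Tₛ-Θ : ∀ {B a} → Supp B a → ∀ j → Tₛ B (Θ a) j ≡ Θ (Tₛ B a) j - a j
Tₛ-Θ {B} {a} supp j = begin
  sumTo B (λ k → Θ a (suc (j ℕ.+ k)) * recip k)        ≡⟨ sumTo-cong B term ⟩
  sumTo B ((ℕ→ℚ j • quotient) ⊞ difference)             ≡⟨ sumTo-⊞ B (ℕ→ℚ j • quotient) difference ⟩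
  sumTo B (ℕ→ℚ j • quotient) + sumTo B difference       ≡⟨ cong₂ _+_ (trans (sumTo-• B (ℕ→ℚ j) quotient) (main j)) tele ⟩
  Θ (Tₛ B a) j + (0ℚ - a j)                             ≡⟨ solve 2 (λ x y → x :+ (con 0ℚ :- y) := x :- y) refl (Θ (Tₛ B a) j) (a j) ⟩
  Θ (Tₛ B a) j - a j                                    ∎
  where
  open ≡-Reasoning
  difference quotient : Seq
  difference k = a (suc (j ℕ.+ k)) - a (j ℕ.+ k)
  quotient k = difference k * recip k
  term : ∀ k → Θ a (suc (j ℕ.+ k)) * recip k ≡ ℕ→ℚ j * quotient k + difference k
  term k = begin
    ℕ→ℚ (suc (j ℕ.+ k)) * difference k * recip k
      ≡⟨ cong (λ x → x * difference k * recip k) (trans (cong ℕ→ℚ (sym (ℕ.+-suc j k))) (ℕ→ℚ-+ j (suc k))) ⟩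
    (ℕ→ℚ j + ℕ→ℚ (suc k)) * difference k * recip k
      ≡⟨ solve 4 (λ j k d r → (j :+ k) :* d :* r := j :* (d :* r) :+ (k :* r) :* d) refl (ℕ→ℚ j) (ℕ→ℚ (suc k)) (difference k) (recip k) ⟩
    ℕ→ℚ j * quotient k + ℕ→ℚ (suc k) * recip k * difference k
      ≡⟨ cong (ℕ→ℚ j * quotient k +_) (trans (cong (_* difference k) (ℕ→ℚ-*-recip k)) (*-identityˡ (difference k))) ⟩
    ℕ→ℚ j * quotient k + difference k ∎
  -- The weight j + k + 1 was split as j + (k + 1), and k + 1 cancels `recip k`. What is left
  -- telescopes, and the support bound removes its upper end.
  tele : sumTo B difference ≡ 0ℚ - a j
  tele = trans (sumTo-cong B (λ k → cong (λ m → a m - a (j ℕ.+ k)) (sym (ℕ.+-suc j k))))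
    (trans (sumTo-telescope B (λ k → a (j ℕ.+ k))) (cong₂ _-_ (supp (j ℕ.+ B) (ℕ.m≤n+m B j)) (cong a (ℕ.+-identityʳ j))))
  main : ∀ j → ℕ→ℚ j * sumTo B (λ k → (a (suc (j ℕ.+ k)) - a (j ℕ.+ k)) * recip k) ≡ Θ (Tₛ B a) j
  main zero    = trans (*-zeroˡ (sumTo B (λ k → (a (suc k) - a k) * recip k))) (sym (*-zeroˡ (E (Tₛ B a) 0)))
  main (suc j) = cong (ℕ→ℚ (suc j) *_) (trans
    (sumTo-cong B (λ k → solve 3 (λ x y r → (x :- y) :* r := x :* r :+ (:- con 1ℚ) :* (y :* r)) refl (a (suc (suc j ℕ.+ k))) (a (suc j ℕ.+ k)) (recip k)))
    (trans (sumTo-⊞ B (λ k → a (suc (suc j ℕ.+ k)) * recip k) ((- 1ℚ) • (λ k → a (suc j ℕ.+ k) * recip k)))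
      (trans (cong (Tₛ B a (suc j) +_) (sumTo-• B (- 1ℚ) (λ k → a (suc j ℕ.+ k) * recip k)))
        (solve 2 (λ x y → x :+ (:- con 1ℚ) :* y := x :- y) refl (Tₛ B a (suc j)) (Tₛ B a j)))))

affine : ℚ → Seq → Seq
affine c r i = (ℕ→ℚ i + c) * r i

Supp-affine : ∀ {d r} c → Supp d (α r) → Supp (suc d) (α (affine c r))
Supp-affine {d} {r} c supp (suc n) (s≤s d≤n) = begin
  α (affine c r) (suc n)                                                  ≡⟨ Θα-affine c r (suc n) ⟨
  ℕ→ℚ (suc n) * (α r (suc n) - α r n) + c * α r (suc n)
    ≡⟨ cong₂ (λ x y → ℕ→ℚ (suc n) * (x - y) + c * x) (supp (suc n) (ℕ.m≤n⇒m≤1+n d≤n)) (supp n d≤n) ⟩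
  ℕ→ℚ (suc n) * (0ℚ - 0ℚ) + c * 0ℚ                                        ≡⟨ cong₂ _+_ (*-zeroʳ (ℕ→ℚ (suc n))) (*-zeroʳ c) ⟩
  0ℚ + 0ℚ                                                                 ≡⟨⟩
  0ℚ                                                                      ∎
  where open ≡-Reasoning

binom-⊠-suc : ∀ p M r → affine (ℕ→ℚ p - ℕ→ℚ M) (binom p M ⊠ r) ≗ ℕ→ℚ (suc M) • (binom p (suc M) ⊠ r)
binom-⊠-suc p M r i = trans (sym (*-assoc (ℕ→ℚ i + (ℕ→ℚ p - ℕ→ℚ M)) (binom p M i) (r i)))
  (trans (cong (_* r i) (sym (binom-sucʳ p M i))) (*-assoc (ℕ→ℚ (suc M)) (binom p (suc M) i) (r i)))

-- C(x + p, M) is, up to M!, a product of M affine functions of x, each of which raises the degree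
-- by one.
Supp-binom : ∀ {d r} p M → Supp d (α r) → Supp (M ℕ.+ d) (α (binom p M ⊠ r))
Supp-binom {r = r} p zero    supp n d≤n = trans (respect α-linear (λ i → *-identityˡ (r i)) n) (supp n d≤n)
Supp-binom {r = r} p (suc M) supp n d≤n = ℕ→ℚ-cancelˡ M
  (trans (sym (scal α-linear (ℕ→ℚ (suc M)) (binom p (suc M) ⊠ r) n))
  (trans (respect α-linear (λ i → sym (binom-⊠-suc p M r i)) n)
  (trans (Supp-affine (ℕ→ℚ p - ℕ→ℚ M) (Supp-binom p M supp) n d≤n) (sym (*-zeroʳ (ℕ→ℚ (suc M)))))))

-- Here r′ plays the role of -dr/dx. A relation is used because an arbitrary sequence has no
-- derivative.
Der : ℕ → Seq → Seq → Set
Der B r r′ = Tₛ B (α r) ≗ α r′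

-- The commutator in `Tₛ-Θ` supplies the term -r, which is -d/dx of the factor x + c times r.
Der-affine : ∀ {B r r′} c → Supp B (α r) → Der B r r′ → Der B (affine c r) (affine c r′ ⊞ (- 1ℚ) • r)
Der-affine {B} {r} {r′} c supp der n = begin
  Tₛ B (α (affine c r)) n                        ≡⟨ respect (Tₛ-linear B) (λ i → sym (Θα-affine c r i)) n ⟩
  Tₛ B (Θ (α r) ⊞ c • α r) n                     ≡⟨ trans (add (Tₛ-linear B) (Θ (α r)) (c • α r) n) (cong₂ _+_ (Tₛ-Θ supp n) (scal (Tₛ-linear B) c (α r) n)) ⟩
  (Θ (Tₛ B (α r)) n - α r n) + c * Tₛ B (α r) n  ≡⟨ cong₂ (λ x y → (x - α r n) + c * y) (respect (∘-linear ϑ-linear E-linear) der n) (der n) ⟩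
  (Θ (α r′) n - α r n) + c * α r′ n
    ≡⟨ solve 4 (λ x y c z → (x :- y) :+ c :* z := (x :+ c :* z) :- con 1ℚ :* y) refl (Θ (α r′) n) (α r n) c (α r′ n) ⟩
  (Θ (α r′) n + c * α r′ n) - 1ℚ * α r n         ≡⟨ cong (_- 1ℚ * α r n) (Θα-affine c r′ n) ⟩
  α (affine c r′) n - 1ℚ * α r n                 ≡⟨ sub α-linear 1ℚ (affine c r′) r n ⟨
  α (affine c r′ ⊞ (- 1ℚ) • r) n                 ∎
  where open ≡-Reasoning

-- The index n stands for the denominator n + 1, as in `recip`, so the sign is (-1)^(n + 1).
sgn : ℕ → ℚ
sgn zero    = - 1ℚ
sgn (suc n) = - sgn n

-- dbinom p 0 M is -d/dx C(x + p, M) = Σ_{k = 1}^{M} (-1)^k / k C(x + p, M - k), i.e. -log(1 + Δ) applied to C(x + p, M).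
dbinom : ℕ → ℕ → ℕ → Seq
dbinom p n zero    i = 0ℚ
dbinom p n (suc M) i = sgn n * recip n * binom p M i + dbinom p (suc n) M i

ℕ→ℚ-*-sgn-recip : ∀ n → ℕ→ℚ (suc n) * (sgn n * recip n) ≡ sgn n
ℕ→ℚ-*-sgn-recip n = trans (solve 3 (λ k s r → k :* (s :* r) := (k :* r) :* s) refl (ℕ→ℚ (suc n)) (sgn n) (recip n))
  (trans (cong (_* sgn n) (ℕ→ℚ-*-recip n)) (*-identityˡ (sgn n)))

-- At n = 0 this is -d/dx of the recurrence `binom-sucʳ`. The offset n is carried because `dbinom`
-- recurses into `suc n`; the sum n + M stays fixed along the induction.
dbinom-suc : ∀ p n M i → ℕ→ℚ (suc (n ℕ.+ M)) * dbinom p n (suc M) i ≡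
  (ℕ→ℚ i + (ℕ→ℚ p - ℕ→ℚ (n ℕ.+ M))) * dbinom p n M i + sgn n * binom p M i
dbinom-suc p n zero i = begin
  ℕ→ℚ (suc (n ℕ.+ 0)) * (c * f + 0ℚ)    ≡⟨ cong (λ m → ℕ→ℚ (suc m) * (c * f + 0ℚ)) (ℕ.+-identityʳ n) ⟩
  ℕ→ℚ (suc n) * (c * f + 0ℚ)            ≡⟨ solve 3 (λ k c f → k :* (c :* f :+ con 0ℚ) := (k :* c) :* f) refl (ℕ→ℚ (suc n)) c f ⟩
  ℕ→ℚ (suc n) * c * f                   ≡⟨ cong (_* f) (ℕ→ℚ-*-sgn-recip n) ⟩
  sgn n * f                             ≡⟨ solve 2 (λ x y → y := x :* con 0ℚ :+ y) refl x (sgn n * f) ⟩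
  x * 0ℚ + sgn n * f                    ∎
  where
  open ≡-Reasoning
  c = sgn n * recip n
  f = binom p 0 i
  x = ℕ→ℚ i + (ℕ→ℚ p - ℕ→ℚ (n ℕ.+ 0))
dbinom-suc p n (suc M) i = begin
  ℕ→ℚ (suc (n ℕ.+ suc M)) * (c * f₁ + S₁)   ≡⟨ cong (λ k → ℕ→ℚ (suc k) * (c * f₁ + S₁)) (ℕ.+-suc n M) ⟩
  N * (c * f₁ + S₁)                         ≡⟨ *-distribˡ-+ N (c * f₁) S₁ ⟩
  N * (c * f₁) + N * S₁                     ≡⟨ cong₂ (λ k y → k * (c * f₁) + y) N≡ (dbinom-suc p (suc n) M i) ⟩
  (ℕ→ℚ (suc n) + ℕ→ℚ (suc M)) * (c * f₁) + (x * S₀ + (- sgn n) * f₀)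
    ≡⟨ solve 7 (λ n m c f₁ x S₀ s → (n :+ m) :* (c :* f₁) :+ (x :* S₀ :+ s) := (n :* c) :* f₁ :+ c :* (m :* f₁) :+ (x :* S₀ :+ s)) refl
         (ℕ→ℚ (suc n)) (ℕ→ℚ (suc M)) c f₁ x S₀ ((- sgn n) * f₀) ⟩
  ℕ→ℚ (suc n) * c * f₁ + c * (ℕ→ℚ (suc M) * f₁) + (x * S₀ + (- sgn n) * f₀)
    ≡⟨ cong₂ (λ s y → s * f₁ + c * y + (x * S₀ + (- sgn n) * f₀)) (ℕ→ℚ-*-sgn-recip n) (binom-sucʳ p M i) ⟩
  sgn n * f₁ + c * ((I + (P - ℕ→ℚ M)) * f₀) + (x * S₀ + (- sgn n) * f₀)
    ≡⟨ cong (λ s → sgn n * f₁ + c * ((I + (P - ℕ→ℚ M)) * f₀) + (x * S₀ + (- s) * f₀)) (ℕ→ℚ-*-sgn-recip n) ⟨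
  sgn n * f₁ + c * ((I + (P - ℕ→ℚ M)) * f₀) + (x * S₀ + (- (ℕ→ℚ (suc n) * c)) * f₀)
    ≡⟨ cong (λ x → sgn n * f₁ + c * ((I + (P - ℕ→ℚ M)) * f₀) + (x * S₀ + (- (ℕ→ℚ (suc n) * c)) * f₀)) x≡ ⟩
  sgn n * f₁ + c * ((I + (P - ℕ→ℚ M)) * f₀) + ((I + (P - (ℕ→ℚ (suc n) + ℕ→ℚ M))) * S₀ + (- (ℕ→ℚ (suc n) * c)) * f₀)
    ≡⟨ solve 8 (λ s c i p m n f₀ S₀ → s :+ c :* ((i :+ (p :- m)) :* f₀) :+ ((i :+ (p :- (n :+ m))) :* S₀ :+ (:- (n :* c)) :* f₀)
                := (i :+ (p :- (n :+ m))) :* (c :* f₀ :+ S₀) :+ s) refl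
         (sgn n * f₁) c I P (ℕ→ℚ M) (ℕ→ℚ (suc n)) f₀ S₀ ⟩
  (I + (P - (ℕ→ℚ (suc n) + ℕ→ℚ M))) * (c * f₀ + S₀) + sgn n * f₁
    ≡⟨ cong (λ y → (I + (P - y)) * (c * f₀ + S₀) + sgn n * f₁) (trans (sym (ℕ→ℚ-+ (suc n) M)) (cong ℕ→ℚ (sym (ℕ.+-suc n M)))) ⟩
  (I + (P - ℕ→ℚ (n ℕ.+ suc M))) * (c * f₀ + S₀) + sgn n * f₁  ∎
  where
  open ≡-Reasoning
  c = sgn n * recip n
  f₀ = binom p M i
  f₁ = binom p (suc M) i
  S₀ = dbinom p (suc n) M i
  S₁ = dbinom p (suc n) (suc M) i
  N = ℕ→ℚ (suc (suc (n ℕ.+ M)))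
  I = ℕ→ℚ i
  P = ℕ→ℚ p
  x = I + (P - ℕ→ℚ (suc n ℕ.+ M))
  N≡ : N ≡ ℕ→ℚ (suc n) + ℕ→ℚ (suc M)
  N≡ = trans (cong (λ k → ℕ→ℚ (suc k)) (sym (ℕ.+-suc n M))) (ℕ→ℚ-+ (suc n) (suc M))
  x≡ : x ≡ I + (P - (ℕ→ℚ (suc n) + ℕ→ℚ M))
  x≡ = cong (λ y → I + (P - y)) (ℕ→ℚ-+ (suc n) M)

-- The binomial is built up one affine factor at a time with `Der-affine`; M + d is the degree bound
-- reached, and it has to stay within the truncation.
Der-binom : ∀ {B d r r′} p M → Supp d (α r) → M ℕ.+ d ℕ.≤ B → Der B r r′ →
  Der B (binom p M ⊠ r) (dbinom p 0 M ⊠ r ⊞ binom p M ⊠ r′)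
Der-binom {B} {r = r} {r′} p zero supp ≤B der n = trans (respect (Tₛ-linear B) (respect α-linear (λ i → *-identityˡ (r i))) n)
  (trans (der n) (respect α-linear (λ i → solve 2 (λ x y → y := con 0ℚ :* x :+ con 1ℚ :* y) refl (r i) (r′ i)) n))
Der-binom {B} {r = r} {r′} p (suc M) supp ≤B der n = ℕ→ℚ-cancelˡ M (begin
  k * Tₛ B (α (binom p (suc M) ⊠ r)) n       ≡⟨ scal (∘-linear (Tₛ-linear B) α-linear) k (binom p (suc M) ⊠ r) n ⟨
  Tₛ B (α (k • (binom p (suc M) ⊠ r))) n     ≡⟨ respect (∘-linear (Tₛ-linear B) α-linear) (λ i → sym (binom-⊠-suc p M r i)) n ⟩
  Tₛ B (α (affine c (binom p M ⊠ r))) n      ≡⟨ Der-affine c (Supp-mono (ℕ.<⇒≤ ≤B) (Supp-binom p M supp)) (Der-binom p M supp (ℕ.<⇒≤ ≤B) der) n ⟩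
  α (affine c (dbinom p 0 M ⊠ r ⊞ binom p M ⊠ r′) ⊞ (- 1ℚ) • (binom p M ⊠ r)) n   ≡⟨ respect α-linear collect n ⟩
  α (k • (dbinom p 0 (suc M) ⊠ r ⊞ binom p (suc M) ⊠ r′)) n       ≡⟨ scal α-linear k (dbinom p 0 (suc M) ⊠ r ⊞ binom p (suc M) ⊠ r′) n ⟩
  k * α (dbinom p 0 (suc M) ⊠ r ⊞ binom p (suc M) ⊠ r′) n         ∎)
  where
  open ≡-Reasoning
  k = ℕ→ℚ (suc M)
  c = ℕ→ℚ p - ℕ→ℚ M
  collect : affine c (dbinom p 0 M ⊠ r ⊞ binom p M ⊠ r′) ⊞ (- 1ℚ) • (binom p M ⊠ r) ≗
            k • (dbinom p 0 (suc M) ⊠ r ⊞ binom p (suc M) ⊠ r′)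
  collect i = begin
    (ℕ→ℚ i + c) * (dbinom p 0 M i * r i + binom p M i * r′ i) + (- 1ℚ) * (binom p M i * r i)
      ≡⟨ solve 5 (λ x d r b r′ → x :* (d :* r :+ b :* r′) :+ (:- con 1ℚ) :* (b :* r) := (x :* d :+ (:- con 1ℚ) :* b) :* r :+ (x :* b) :* r′) refl
           (ℕ→ℚ i + c) (dbinom p 0 M i) (r i) (binom p M i) (r′ i) ⟩
    ((ℕ→ℚ i + c) * dbinom p 0 M i + (- 1ℚ) * binom p M i) * r i + (ℕ→ℚ i + c) * binom p M i * r′ i
      ≡⟨ cong₂ (λ x y → x * r i + y * r′ i) (sym (dbinom-suc p 0 M i)) (sym (binom-sucʳ p M i)) ⟩
    k * dbinom p 0 (suc M) i * r i + k * binom p (suc M) i * r′ i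
      ≡⟨ solve 5 (λ k d r b r′ → k :* d :* r :+ k :* b :* r′ := k :* (d :* r :+ b :* r′)) refl k (dbinom p 0 (suc M) i) (r i) (binom p (suc M) i) (r′ i) ⟩
    k * (dbinom p 0 (suc M) i * r i + binom p (suc M) i * r′ i) ∎

-- Denominators of the coefficients of Tᵐ

IsInt : ℚ → Set
IsInt x = Σ ℤ λ k → x ≡ ℤ→ℚ k

IsInt-+ : ∀ {x y} → IsInt x → IsInt y → IsInt (x + y)
IsInt-+ (k , refl) (l , refl) = k ℤ.+ l , sym (ℤ→ℚ-+ k l)

IsInt-* : ∀ {x y} → IsInt x → IsInt y → IsInt (x * y)
IsInt-* (k , refl) (l , refl) = k ℤ.* l , sym (ℤ→ℚ-* k l)

IsInt-neg : ∀ {x} → IsInt x → IsInt (- x)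
IsInt-neg (k , refl) = ℤ.- k , sym (ℤ→ℚ-neg k)

IsInt-ℕ : ∀ n → IsInt (ℕ→ℚ n)
IsInt-ℕ n = ℤ.+ n , refl

IsInt-sgn : ∀ n → IsInt (sgn n)
IsInt-sgn zero    = IsInt-neg (IsInt-ℕ 1)
IsInt-sgn (suc n) = IsInt-neg (IsInt-sgn n)

α-int : ∀ {r} → (∀ i → IsInt (r i)) → ∀ n → IsInt (α r n)
α-int int zero    = int 0
α-int int (suc n) = α-int (λ i → IsInt-+ (int i) (IsInt-neg (int (suc i)))) n

State : Set
State = List (ℕ × ℕ)

binoms-int : ∀ s i → IsInt (binoms s i)
binoms-int []            i = IsInt-ℕ 1
binoms-int ((p , M) ∷ s) i = IsInt-* (IsInt-ℕ ((i ℕ.+ p) C M)) (binoms-int s i)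

dbinoms : State → Seq
dbinoms []            = λ _ → 0ℚ
dbinoms ((p , M) ∷ s) = dbinom p 0 M ⊠ binoms s ⊞ binom p M ⊠ dbinoms s

-- One more than the degree of binoms s.
size : State → ℕ
size []            = 1
size ((p , M) ∷ s) = M ℕ.+ size s

Supp-binoms : ∀ s → Supp (size s) (α (binoms s))
Supp-binoms []            (suc n) _ = α-const (suc n)
Supp-binoms ((p , M) ∷ s)           = Supp-binom p M (Supp-binoms s)

Der-binoms : ∀ {B} s → size s ℕ.≤ B → Der B (binoms s) (dbinoms s)
Der-binoms {B} [] ≤B n = trans (sumTo-zero B (λ k → trans (cong (_* recip k) (α-const (suc (n ℕ.+ k)))) (*-zeroˡ (recip k)))) (sym (α-zero n))
  where
  α-zero : ∀ n → α (λ _ → 0ℚ) n ≡ 0ℚ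
  α-zero n = trans (respect α-linear {b = 0ℚ • (λ _ → 0ℚ)} (λ _ → refl) n) (trans (scal α-linear 0ℚ (λ _ → 0ℚ) n) (*-zeroˡ (α (λ _ → 0ℚ) n)))
Der-binoms ((p , M) ∷ s) ≤B = Der-binom p M (Supp-binoms s) ≤B (Der-binoms s (ℕ.≤-trans (ℕ.m≤n+m (size s) M) ≤B))

-- Move s n s′: the term (-1)^(n+1) / (n+1) · binoms s′ occurs in dbinoms s.
data Move : State → ℕ → State → Set where
  here  : ∀ {p n M M′ s} → suc (n ℕ.+ M) ≡ M′ → Move ((p , M′) ∷ s) n ((p , M) ∷ s)
  there : ∀ {x n s s′} → Move s n s′ → Move (x ∷ s) n (x ∷ s′)

size-Move : ∀ {s n s′} → Move s n s′ → size s′ ℕ.≤ size s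
size-Move {s = (p , _) ∷ s} (here {n = n} {M} refl) = ℕ.+-monoˡ-≤ (size s) (ℕ.m≤n⇒m≤1+n (ℕ.m≤n+m M n))
size-Move (there {x = p , M} mv)   = ℕ.+-monoʳ-≤ M (size-Move mv)

-- Closure properties that let a claim about `dbinoms s` be checked term by term, although its terms
-- are never listed.
record Additive (Q : Seq → Set) : Set where
  field
    Q-zero : Q (λ _ → 0ℚ)
    Q-add  : ∀ {r s} → Q r → Q s → Q (r ⊞ s)
    Q-resp : ∀ {r s} → r ≗ s → Q r → Q s

dbinoms-ind : ∀ {Q} → Additive Q → ∀ s → (∀ {n s′} → Move s n s′ → Q ((sgn n * recip n) • binoms s′)) → Q (dbinoms s)
dbinoms-ind     A []            terms = Additive.Q-zero A
dbinoms-ind {Q} A ((p , M) ∷ s) terms = Q-add (head 0 M (λ {n} {l} eq → Q-resp (λ i → sym (*-assoc (sgn n * recip n) (binom p l i) (binoms s i))) (terms (here {n = n} {M = l} eq))))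
  (dbinoms-ind tail s (λ {n} {s′} mv → Q-resp
    (λ i → solve 3 (λ c b x → c :* (b :* x) := b :* (c :* x)) refl (sgn n * recip n) (binom p M i) (binoms s′ i)) (terms (there mv))))
  where
  open Additive A
  -- When a later factor is differentiated the first one is a fixed multiplier, so the predicate is
  -- pulled back along it.
  tail : Additive (λ r → Q (binom p M ⊠ r))
  tail = record
    { Q-zero = Q-resp (λ i → sym (*-zeroʳ (binom p M i))) Q-zero
    ; Q-add  = λ {r} {s} qr qs → Q-resp (λ i → sym (*-distribˡ-+ (binom p M i) (r i) (s i))) (Q-add qr qs)
    ; Q-resp = λ r≗s → Q-resp (λ i → cong (binom p M i *_) (r≗s i))
    }
  -- The sum n + l keeps the value M throughout, which is the equation that `here` asks for.
  head : ∀ n l → (∀ {n′ l′} → suc (n′ ℕ.+ l′) ≡ n ℕ.+ l → Q (λ i → sgn n′ * recip n′ * binom p l′ i * binoms s i)) →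
    Q (dbinom p n l ⊠ binoms s)
  head n zero    q = Q-resp (λ i → sym (*-zeroˡ (binoms s i))) Q-zero
  head n (suc l) q = Q-resp (λ i → sym (*-distribʳ-+ (binoms s i) (sgn n * recip n * binom p l i) (dbinom p (suc n) l i)))
    (Q-add (q {n} {l} (sym (ℕ.+-suc n l))) (head (suc n) l (λ {n′} {l′} eq → q {n′} {l′} (trans eq (sym (ℕ.+-suc n l))))))

data Moves : State → List ℕ → Set where
  stop : ∀ {s} → Moves s []
  move : ∀ {s s′ n ns} → Move s n s′ → Moves s′ ns → Moves s (suc n ∷ ns)

-- Lists shorter than m are included in the hypothesis for the sake of the induction: the
-- one-element list gives d = (n + 1) e, and e then satisfies the hypothesis for the remaining m
-- moves.
T-binoms-int : ∀ {B} m d s → size s ℕ.≤ B → (∀ ns → length ns ℕ.≤ m → Moves s ns → product ns ∣ d) →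
  ∀ j → IsInt (ℕ→ℚ d * (Tₛ B ^∘ m) (α (binoms s)) j)
T-binoms-int     zero    d s ≤B div j = IsInt-* (IsInt-ℕ d) (α-int (binoms-int s) j)
T-binoms-int {B} (suc m) d s ≤B div j = subst (λ x → IsInt (ℕ→ℚ d * x))
  (trans (sym (respect T^m (Der-binoms s ≤B) j)) (^∘-comm (Tₛ-linear B) (Tₛ-linear B) (λ _ _ → refl) m (α (binoms s)) j))
  (dbinoms-ind additive s term j)
  where
  T^m = ^∘-linear (Tₛ-linear B) m
  T^mα = ∘-linear T^m α-linear
  Q : Seq → Set
  Q r = ∀ j → IsInt (ℕ→ℚ d * (Tₛ B ^∘ m) (α r) j)
  additive : Additive Q
  additive = record
    { Q-zero = λ j → subst IsInt (sym (trans (cong (ℕ→ℚ d *_) (trans (respect T^mα {b = 0ℚ • (λ _ → 0ℚ)} (λ _ → refl) j)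
        (trans (scal T^mα 0ℚ (λ _ → 0ℚ) j) (*-zeroˡ ((Tₛ B ^∘ m) (α (λ _ → 0ℚ)) j))))) (*-zeroʳ (ℕ→ℚ d)))) (IsInt-ℕ 0)
    ; Q-add  = λ {r} {s} qr qs j → subst IsInt (trans (sym (*-distribˡ-+ (ℕ→ℚ d) ((Tₛ B ^∘ m) (α r) j) ((Tₛ B ^∘ m) (α s) j)))
        (cong (ℕ→ℚ d *_) (sym (add T^mα r s j)))) (IsInt-+ (qr j) (qs j))
    ; Q-resp = λ r≗s qr j → subst (λ x → IsInt (ℕ→ℚ d * x)) (respect T^mα r≗s j) (qr j)
    }
  term : ∀ {n s′} → Move s n s′ → Q ((sgn n * recip n) • binoms s′)
  term {n} {s′} mv j with div (suc n ∷ []) (s≤s z≤n) (move mv stop)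
  ... | divides e d≡ = subst IsInt (sym rearrange)
    (IsInt-* (IsInt-sgn n) (T-binoms-int m e s′ (ℕ.≤-trans (size-Move mv) ≤B) div′ j))
    where
    d≡′ : d ≡ suc n ℕ.* e
    d≡′ = trans d≡ (trans (cong (e ℕ.*_) (ℕ.*-identityʳ (suc n))) (ℕ.*-comm e (suc n)))
    div′ : ∀ ns → length ns ℕ.≤ m → Moves s′ ns → product ns ∣ e
    div′ ns ≤m mvs = ℕ∣.*-cancelˡ-∣ (suc n) (subst (suc n ℕ.* product ns ∣_) d≡′ (div (suc n ∷ ns) (s≤s ≤m) (move mv mvs)))
    x = (Tₛ B ^∘ m) (α (binoms s′)) j
    rearrange : ℕ→ℚ d * (Tₛ B ^∘ m) (α ((sgn n * recip n) • binoms s′)) j ≡ sgn n * (ℕ→ℚ e * x)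
    rearrange = trans (cong₂ _*_ (trans (cong ℕ→ℚ d≡′) (ℕ→ℚ-* (suc n) e)) (scal T^mα (sgn n * recip n) (binoms s′) j))
      (trans (solve 5 (λ k e s r x → (k :* e) :* ((s :* r) :* x) := (k :* r) :* (s :* (e :* x))) refl (ℕ→ℚ (suc n)) (ℕ→ℚ e) (sgn n) (recip n) x)
        (trans (cong (_* (sgn n * (ℕ→ℚ e * x))) (ℕ→ℚ-*-recip n)) (*-identityˡ _)))

-- Bounding the denominators by d_{N₁ t} ⋯ d_{N_m t}

ind : ℕ → ℕ → ℕ
ind ν x with ν ℕ.≤? x
... | yes _ = 1
... | no  _ = 0

ind-≤ : ∀ {ν x} → ν ℕ.≤ x → ind ν x ≡ 1
ind-≤ {ν} {x} ν≤x with ν ℕ.≤? x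
... | yes _   = refl
... | no  ν≰x = contradiction ν≤x ν≰x

ind-> : ∀ {ν x} → x ℕ.< ν → ind ν x ≡ 0
ind-> {ν} {x} x<ν with ν ℕ.≤? x
... | yes ν≤x = contradiction ν≤x (ℕ.<⇒≱ x<ν)
... | no  _   = refl

count : ℕ → List ℕ → ℕ
count ν = sum ∘ map (ind ν)

count-↭ : ∀ ν {xs ys} → xs ↭ ys → count ν xs ≡ count ν ys
count-↭ ν xs↭ys = sum-↭ (map⁺ (ind ν) xs↭ys)

count-> : ∀ {ν xs} → All (ℕ._< ν) xs → count ν xs ≡ 0
count-> []         = refl
count-> (x<ν ∷ xs) = cong₂ ℕ._+_ (ind-> x<ν) (count-> xs)

count-length : ∀ ν xs → count ν xs ℕ.≤ length xs
count-length ν []       = z≤n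
count-length ν (x ∷ xs) with ν ℕ.≤? x
... | yes _ = s≤s (count-length ν xs)
... | no  _ = ℕ.m≤n⇒m≤1+n (count-length ν xs)

-- A lower index M leaves room for at most ⌊M / ν⌋ subtractions of ν or more; this is the total over
-- all factors.
capacity : (ν : ℕ) .{{_ : NonZero ν}} → State → ℕ
capacity ν s = sum (map (λ pM → proj₂ pM / ν) s)

Move-capacity : ∀ ν .{{_ : NonZero ν}} {s n s′} → Move s n s′ → ind ν (suc n) ℕ.+ capacity ν s′ ℕ.≤ capacity ν s
Move-capacity ν {s = (_ , M′) ∷ s} {n} (here {M = M} refl) = subst (ℕ._≤ (M′ / ν) ℕ.+ capacity ν s)
  (ℕ.+-assoc (ind ν (suc n)) (M / ν) (capacity ν s)) (ℕ.+-monoˡ-≤ (capacity ν s) bound)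
  where
  bound : ind ν (suc n) ℕ.+ M / ν ℕ.≤ suc (n ℕ.+ M) / ν
  bound with ν ℕ.≤? suc n
  ... | yes ν≤n = subst (ℕ._≤ suc (n ℕ.+ M) / ν)
        (trans (ℕ/.+-distrib-/-∣ˡ M (ℕ∣.∣-refl {ν})) (cong (ℕ._+ M / ν) (ℕ/.n/n≡1 ν)))
        (ℕ/./-monoˡ-≤ ν (ℕ.+-monoˡ-≤ M ν≤n))
  ... | no  _   = ℕ/./-monoˡ-≤ ν (ℕ.m≤n+m M (suc n))
Move-capacity ν {n = n} (there {x = _ , M} {s = s} {s′ = s′} mv) = subst (ℕ._≤ M / ν ℕ.+ capacity ν s)
  (trans (sym (ℕ.+-assoc (M / ν) (ind ν (suc n)) (capacity ν s′)))
    (trans (cong (ℕ._+ capacity ν s′) (ℕ.+-comm (M / ν) (ind ν (suc n)))) (ℕ.+-assoc (ind ν (suc n)) (M / ν) (capacity ν s′))))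
  (ℕ.+-monoʳ-≤ (M / ν) (Move-capacity ν mv))

Moves-capacity : ∀ ν .{{_ : NonZero ν}} {s ns} → Moves s ns → count ν ns ℕ.≤ capacity ν s
Moves-capacity ν stop                          = z≤n
Moves-capacity ν (move {n = n} mv mvs) = ℕ.≤-trans (ℕ.+-monoʳ-≤ (ind ν (suc n)) (Moves-capacity ν mvs)) (Move-capacity ν mv)

Moves-positive : ∀ {s ns} → Moves s ns → All NonZero ns
Moves-positive stop         = []
Moves-positive (move _ mvs) = _ ∷ Moves-positive mvs

maximum : ∀ x xs → ∃ λ y → ∃ λ ys → (x ∷ xs ↭ y ∷ ys) × All (ℕ._≤ y) ys
maximum x []        = x , [] , ↭-refl , []
maximum x (x′ ∷ xs) with maximum x′ xs
... | y , ys , perm , ys≤y with x ℕ.≤? y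
... | yes x≤y = y , x ∷ ys , ↭-trans (prep x perm) (swap x y refl) , x≤y ∷ ys≤y
... | no  x≰y = x , y ∷ ys , prep x perm , y≤x ∷ All.map (λ z≤y → ℕ.≤-trans z≤y y≤x) ys≤y
  where y≤x = ℕ.<⇒≤ (ℕ.≰⇒> x≰y)

∣-foldr-lcm : ∀ (f : ℕ → ℕ) {i k} → i ℕ.< k → f i ∣ foldr lcm 1 (applyUpTo f k)
∣-foldr-lcm f {zero}  {suc k} _         = m∣lcm[m,n] (f 0) (foldr lcm 1 (applyUpTo (f ∘ suc) k))
∣-foldr-lcm f {suc i} {suc k} (s≤s i<k) = ℕ∣.∣-trans (∣-foldr-lcm (f ∘ suc) i<k) (n∣lcm[m,n] (f 0) (foldr lcm 1 (applyUpTo (f ∘ suc) k)))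

∣-dlcm : ∀ {x k} .{{_ : NonZero x}} → x ℕ.≤ k → x ∣ dlcm k
∣-dlcm {suc i} {k} i<k = subst (λ xs → suc i ∣ foldr lcm 1 xs) (sym (L.map-upTo suc k)) (∣-foldr-lcm suc i<k)

nth : List ℕ → ℕ → ℕ
nth xs j = fromMaybe 0 (L.head (drop j xs))

-- By the hypothesis on counts the j-th largest element of ns is at most t times the j-th element of Ks, hence at most f j.
product-∣-dlcm : ∀ m t Ks ns f → AllPairs ℕ._≥_ Ks → All NonZero ns → length ns ℕ.≤ m →
  (∀ ν → .{{NonZero ν}} → count ν ns ℕ.≤ count ν (map (ℕ._* t) Ks)) → (∀ j → nth Ks j ℕ.* t ℕ.≤ f j) →
  product ns ∣ product (applyUpTo (dlcm ∘ f) m)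
product-∣-dlcm m       t Ks []       f sorted pos ≤m dom ≤f = ℕ∣.1∣ _
product-∣-dlcm (suc m) t Ks (x ∷ xs) f sorted pos ≤m dom ≤f with maximum x xs
... | y , ys , perm , ys≤y = step Ks sorted dom ≤f
  where
  pos′ : All NonZero (y ∷ ys)
  pos′ = All-resp-↭ perm pos
  instance
    y≢0 : NonZero y
    y≢0 = All.head pos′
  step : ∀ Ks → AllPairs ℕ._≥_ Ks → (∀ ν → .{{NonZero ν}} → count ν (x ∷ xs) ℕ.≤ count ν (map (ℕ._* t) Ks)) →
    (∀ j → nth Ks j ℕ.* t ℕ.≤ f j) → product (x ∷ xs) ∣ product (applyUpTo (dlcm ∘ f) (suc m))
  y-counted : 1 ℕ.≤ count y (x ∷ xs)
  y-counted = subst (1 ℕ.≤_) (trans (cong (ℕ._+ count y ys) (sym (ind-≤ (ℕ.≤-refl {y})))) (sym (count-↭ y perm))) (s≤s z≤n)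
  step []       sorted           dom ≤f = contradiction (ℕ.≤-trans y-counted (dom y)) λ ()
  step (k ∷ Ks) (k≥ ∷ sorted) dom ≤f with y ℕ.≤? k ℕ.* t
  ... | no  y≰kt = contradiction (ℕ.≤-trans y-counted (subst (count y (x ∷ xs) ℕ.≤_) (count-> (kt<y ∷ below k≥)) (dom y))) λ ()
    where
    kt<y = ℕ.≰⇒> y≰kt
    below : ∀ {Ks} → All (k ℕ.≥_) Ks → All (ℕ._< y) (map (ℕ._* t) Ks)
    below []         = []
    below (k≥l ∷ k≥) = ℕ.≤-<-trans (ℕ.*-monoˡ-≤ t k≥l) kt<y ∷ below k≥
  ... | yes y≤kt = subst (_∣ product (applyUpTo (dlcm ∘ f) (suc m))) (sym (product-↭ perm))
    (ℕ∣.*-pres-∣ (∣-dlcm (ℕ.≤-trans y≤kt (≤f 0)))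
      (product-∣-dlcm m t Ks ys (f ∘ suc) sorted (All.tail pos′) (ℕ.s≤s⁻¹ (subst (ℕ._≤ suc m) (↭-length perm) ≤m)) dom′ (≤f ∘ suc)))
    where
    -- For ν ≤ y both y and k t are counted, so 1 drops out on either side. For ν > y nothing in
    -- `ys` is counted, since y is the maximum.
    dom′ : ∀ ν → .{{NonZero ν}} → count ν ys ℕ.≤ count ν (map (ℕ._* t) Ks)
    dom′ ν with ν ℕ.≤? y
    ... | yes ν≤y = ℕ.+-cancelˡ-≤ 1 _ _ (subst₂ ℕ._≤_
          (trans (count-↭ ν perm) (cong (ℕ._+ count ν ys) (ind-≤ ν≤y)))
          (cong (ℕ._+ count ν (map (ℕ._* t) Ks)) (ind-≤ (ℕ.≤-trans ν≤y y≤kt))) (dom ν))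
    ... | no  ν≰y = ℕ.≤-trans (ℕ.≤-reflexive (count-> (All.map (λ z≤y → ℕ.≤-<-trans z≤y (ℕ.≰⇒> ν≰y)) ys≤y))) z≤n

∈⇒≤sum : ∀ {A : Set} (f : A → ℕ) {x xs} → x ∈ xs → f x ℕ.≤ sum (map f xs)
∈⇒≤sum f {xs = y ∷ xs} (here refl)  = ℕ.m≤m+n (f y) (sum (map f xs))
∈⇒≤sum f {xs = y ∷ xs} (there x∈xs) = ℕ.≤-trans (∈⇒≤sum f x∈xs) (ℕ.m≤n+m (sum (map f xs)) (f y))

length≤sum : ∀ {A : Set} (f : A → ℕ) xs → (∀ x → 1 ℕ.≤ f x) → length xs ℕ.≤ sum (map f xs)
length≤sum f []       f≥1 = z≤n
length≤sum f (x ∷ xs) f≥1 = ℕ.+-mono-≤ (f≥1 x) (length≤sum f xs f≥1)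

sum-map-concatMap : ∀ {A B : Set} (g : B → ℕ) (f : A → List B) xs →
  sum (map g (concatMap f xs)) ≡ sum (map (λ x → sum (map g (f x))) xs)
sum-map-concatMap g f []       = refl
sum-map-concatMap g f (x ∷ xs) = trans (cong sum (L.map-++ g (f x) (concatMap f xs)))
  (trans (sum-++ (map g (f x)) (map g (concatMap f xs))) (cong (sum (map g (f x)) ℕ.+_) (sum-map-concatMap g f xs)))

AllPairs-reverse : ∀ {xs} → AllPairs ℕ._≤_ xs → AllPairs ℕ._≥_ (reverse xs)
AllPairs-reverse {[]}     []         = []
AllPairs-reverse {x ∷ xs} (x≤ ∷ xs≤) = subst (AllPairs ℕ._≥_) (sym (L.unfold-reverse x xs))
  (AllPairs.++⁺ (AllPairs-reverse xs≤) ([] ∷ []) (All-resp-↭ (↭-sym (↭-reverse xs)) (All.map (λ x≤y → x≤y ∷ []) x≤)))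

-- Counting large entries of the matrix (p i + q j) t

module _ (n : ℕ) (p q : Fin n → ℕ) where

  entries : List ℕ
  entries = concatMap (λ i → map (λ j → p i ℕ.+ q j) (allFin n)) (allFin n)

  Klist-↭ : Klist n p q ↭ entries
  Klist-↭ = ↭-trans (↭-reverse _) (Sort.sort-↭ entries)

  Klist-sorted : AllPairs ℕ._≥_ (Klist n p q)
  Klist-sorted = AllPairs-reverse (Sorted⇒AllPairs ℕ.≤-totalOrder (Sort.sort-↗ entries))

  K-*-≤ : ∀ t j → nth (Klist n p q) j ℕ.* t ℕ.≤ floorNt n p q t (suc j)
  K-*-≤ t j = ℕ.m≤m⊔n _ _

  module _ (t : ℕ) where

    -- A permutation σ enters as the list of its values, so that original and exchanged parameters
    -- are treated alike.
    pairState : List (Fin n) → List (Fin n) → State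
    pairState = zipWith (λ i j → p i ℕ.* t , p i ℕ.* t ℕ.+ q j ℕ.* t)

    entry : Fin n → Fin n → ℕ
    entry i j = (p i ℕ.+ q j) ℕ.* t

    module _ (ν : ℕ) .{{_ : NonZero ν}} where

      row : Fin n → ℕ
      row i = sum (map (λ j → ind ν (entry i j)) (allFin n))

      count-Klist : count ν (map (ℕ._* t) (Klist n p q)) ≡ sum (map row (allFin n))
      count-Klist = begin
        count ν (map (ℕ._* t) (Klist n p q))         ≡⟨ count-↭ ν (map⁺ (ℕ._* t) Klist-↭) ⟩
        count ν (map (ℕ._* t) entries)               ≡⟨ cong sum (L.map-∘ entries) ⟨
        sum (map (ind ν ∘ (ℕ._* t)) entries)         ≡⟨ sum-map-concatMap (ind ν ∘ (ℕ._* t)) (λ i → map (λ j → p i ℕ.+ q j) (allFin n)) (allFin n) ⟩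
        sum (map (λ i → sum (map (ind ν ∘ (ℕ._* t)) (map (λ j → p i ℕ.+ q j) (allFin n)))) (allFin n))
          ≡⟨ cong sum (L.map-cong (λ i → cong sum (sym (L.map-∘ (allFin n)))) (allFin n)) ⟩
        sum (map row (allFin n))                     ∎
        where open ≡-Reasoning

      row-∋ : ∀ i j → ν ℕ.≤ entry i j → 1 ℕ.≤ row i
      row-∋ i j ν≤ = subst (ℕ._≤ row i) (ind-≤ ν≤) (∈⇒≤sum (λ j → ind ν (entry i j)) (∈-allFin j))

      length-allFin : length (allFin n) ≡ n
      length-allFin = L.length-tabulate id

      -- A large entry p i + q j forces p i or q j to be large, hence a whole row or column of large entries.
      large-entry : ∀ i j → ν ℕ.+ ν ℕ.≤ entry i j → n ℕ.≤ sum (map row (allFin n))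
      large-entry i j 2ν≤ with ν ℕ.≤? p i ℕ.* t
      ... | yes ν≤pt = ℕ.≤-trans (subst (ℕ._≤ row i) length-allFin (length≤sum _ (allFin n) λ j →
              ℕ.≤-reflexive (sym (ind-≤ (ℕ.≤-trans ν≤pt (ℕ.*-monoˡ-≤ t (ℕ.m≤m+n (p i) (q j))))))))
              (∈⇒≤sum row (∈-allFin i))
      ... | no  ν≰pt = subst (ℕ._≤ sum (map row (allFin n))) length-allFin
              (length≤sum row (allFin n) λ i → row-∋ i j (ℕ.≤-trans ν≤qt (ℕ.*-monoˡ-≤ t (ℕ.m≤n+m (q j) (p i)))))
        where
        ν≤qt : ν ℕ.≤ q j ℕ.* t
        ν≤qt = ℕ.≮⇒≥ λ qt<ν → ℕ.<⇒≱ (ℕ.+-mono-< (ℕ.≰⇒> ν≰pt) qt<ν) (subst (ν ℕ.+ ν ℕ.≤_) (ℕ.*-distribʳ-+ t (p i) (q j)) 2ν≤)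

      -- An entry below 2ν has quotient 0 or 1, and a quotient 1 is paid for by that same entry in
      -- row i. Any entry from 2ν on is left to `large-entry`.
      pair-capacity : ∀ is js → n ℕ.≤ sum (map row (allFin n)) ⊎ capacity ν (pairState is js) ℕ.≤ sum (map row is)
      pair-capacity []       js       = inj₂ z≤n
      pair-capacity (i ∷ is) []       = inj₂ z≤n
      pair-capacity (i ∷ is) (j ∷ js) with ν ℕ.+ ν ℕ.≤? entry i j | pair-capacity is js
      ... | yes 2ν≤ | _        = inj₁ (large-entry i j 2ν≤)
      ... | no  _   | inj₁ n≤  = inj₁ n≤
      ... | no  2ν≰ | inj₂ cap = inj₂ (ℕ.+-mono-≤ small cap)
        where
        small : (p i ℕ.* t ℕ.+ q j ℕ.* t) / ν ℕ.≤ row i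
        small rewrite sym (ℕ.*-distribʳ-+ t (p i) (q j)) with ν ℕ.≤? entry i j
        ... | yes ν≤ = ℕ.≤-trans (ℕ.s≤s⁻¹ (ℕ/.m<n*o⇒m/o<n {n = 2}
                (subst (entry i j ℕ.<_) (cong (ν ℕ.+_) (sym (ℕ.+-identityʳ ν))) (ℕ.≰⇒> 2ν≰)))) (row-∋ i j ν≤)
        ... | no  ν≰ = subst (ℕ._≤ row i) (sym (ℕ/.m<n⇒m/n≡0 (ℕ.≰⇒> ν≰))) z≤n

    Moves-∣-dprod : ∀ {m} → m ℕ.≤ n → ∀ js ns → length ns ℕ.≤ m → Moves (pairState (allFin n) js) ns →
      product ns ∣ dprod n p q t m
    Moves-∣-dprod {m} m≤n js ns ≤m mvs = subst (product ns ∣_)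
      (cong product (sym (L.map-upTo (λ j → dlcm (floorNt n p q t (suc j))) m)))
      (product-∣-dlcm m t (Klist n p q) ns (λ j → floorNt n p q t (suc j)) Klist-sorted (Moves-positive mvs) ≤m dom (K-*-≤ t))
      where
      dom : ∀ ν → .{{_ : NonZero ν}} → count ν ns ℕ.≤ count ν (map (ℕ._* t) (Klist n p q))
      dom ν = subst (count ν ns ℕ.≤_) (sym (count-Klist ν)) bound
        where
        bound : count ν ns ℕ.≤ sum (map (row ν) (allFin n))
        bound with pair-capacity ν (allFin n) js
        -- At least n entries reach ν, and `ns` has at most m ≤ n members.
        ... | inj₁ n≤  = ℕ.≤-trans (ℕ.≤-trans (count-length ν ns) (ℕ.≤-trans ≤m m≤n)) n≤
        ... | inj₂ cap = ℕ.≤-trans (Moves-capacity ν mvs) cap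

-- Factorials, permutations and valuations

rising : ℕ → Seq
rising zero    i = 1ℚ
rising (suc p) i = (ℕ→ℚ i + ℕ→ℚ (suc p)) * rising p i

falling : ℕ → Seq
falling q i = ℕ→ℚ (q !) * binom 0 q i

-- The p + q consecutive factors from i + p down to i - q + 1 split into those above i, which depend
-- on p alone, and those from i downwards, which depend on q alone. This separation makes the
-- exchange of the q's possible.
factorial-binom : ∀ p q i → ℕ→ℚ ((p ℕ.+ q) !) * binom p (p ℕ.+ q) i ≡ rising p i * falling q i
factorial-binom zero    q i = sym (*-identityˡ (falling q i))
factorial-binom (suc p) q i = begin
  ℕ→ℚ (suc k ℕ.* k !) * binom (suc p) (suc k) i          ≡⟨ cong (_* binom (suc p) (suc k) i) (ℕ→ℚ-* (suc k) (k !)) ⟩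
  ℕ→ℚ (suc k) * ℕ→ℚ (k !) * binom (suc p) (suc k) i
    ≡⟨ solve 3 (λ c f b → c :* f :* b := f :* (c :* b)) refl (ℕ→ℚ (suc k)) (ℕ→ℚ (k !)) (binom (suc p) (suc k) i) ⟩
  ℕ→ℚ (k !) * (ℕ→ℚ (suc k) * binom (suc p) (suc k) i)    ≡⟨ cong (ℕ→ℚ (k !) *_) (binom-sucˡ p k i) ⟩
  ℕ→ℚ (k !) * (x * binom p k i)                          ≡⟨ solve 3 (λ f x b → f :* (x :* b) := x :* (f :* b)) refl (ℕ→ℚ (k !)) x (binom p k i) ⟩
  x * (ℕ→ℚ (k !) * binom p k i)                          ≡⟨ cong (x *_) (factorial-binom p q i) ⟩
  x * (rising p i * falling q i)                         ≡⟨ *-assoc x (rising p i) (falling q i) ⟨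
  rising (suc p) i * falling q i                         ∎
  where
  open ≡-Reasoning
  k = p ℕ.+ q
  x = ℕ→ℚ i + ℕ→ℚ (suc p)

prod : ∀ {A : Set} → (A → ℚ) → List A → ℚ
prod f []       = 1ℚ
prod f (x ∷ xs) = f x * prod f xs

prod-↭ : ∀ {A : Set} (f : A → ℚ) {xs ys} → xs ↭ ys → prod f xs ≡ prod f ys
prod-↭ f refl         = refl
prod-↭ f (prep x eq)  = cong (f x *_) (prod-↭ f eq)
prod-↭ f (swap {xs} {ys} x y eq) = trans (cong (λ z → f x * (f y * z)) (prod-↭ f eq))
  (solve 3 (λ x y z → x :* (y :* z) := y :* (x :* z)) refl (f x) (f y) (prod f ys))
prod-↭ f (↭.trans e e′) = trans (prod-↭ f e) (prod-↭ f e′)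

zipWith-diag : ∀ {A B : Set} (f : A → A → B) xs → zipWith f xs xs ≡ map (λ x → f x x) xs
zipWith-diag f []       = refl
zipWith-diag f (x ∷ xs) = cong (f x x ∷_) (zipWith-diag f xs)

insertions-↭ : ∀ {A : Set} (x : A) xs {ys} → ys ∈ insertions x xs → ys ↭ x ∷ xs
insertions-↭ x []       (here refl) = ↭-refl
insertions-↭ x (y ∷ xs) (here refl) = ↭-refl
insertions-↭ x (y ∷ xs) (there ∈)   with ∈-map⁻ (y ∷_) ∈
... | zs , zs∈ , refl = ↭-trans (prep y (insertions-↭ x xs zs∈)) (swap y x refl)

perms-↭ : ∀ {A : Set} (xs : List A) {ys} → ys ∈ perms xs → ys ↭ xs
perms-↭ []       (here refl) = ↭-refl
perms-↭ (x ∷ xs) ys∈         with find (∈-concatMap⁻ (insertions x) {xs = perms xs} ys∈)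
... | zs , zs∈ , ys∈ = ↭-trans (insertions-↭ x zs ys∈) (prep x (perms-↭ xs zs∈))

foldr-⊔-∈ : ∀ xs → foldr ℕ._⊔_ 0 xs ≡ 0 ⊎ foldr ℕ._⊔_ 0 xs ∈ xs
foldr-⊔-∈ []       = inj₁ refl
foldr-⊔-∈ (x ∷ xs) with ℕ.⊔-sel x (foldr ℕ._⊔_ 0 xs) | foldr-⊔-∈ xs
... | inj₁ eq | _       = inj₂ (here eq)
... | inj₂ eq | inj₁ ≡0 = inj₁ (trans eq ≡0)
... | inj₂ eq | inj₂ ∈  = inj₂ (subst (_∈ x ∷ xs) (sym eq) (there ∈))

-- Valuations at a prime

module _ {s : ℕ} (s-prime : Prime s) where

  private instance
    s≢0 : NonZero s
    s≢0 = prime⇒nonZero s-prime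

  prime∤1 : s ∤ 1
  prime∤1 s∣1 = ¬prime[1] (subst Prime (ℕ∣.∣1⇒≡1 s∣1) s-prime)

  prime∤* : ∀ {u v} → s ∤ u → s ∤ v → s ∤ u ℕ.* v
  prime∤* {u} {v} s∤u s∤v s∣uv with euclidsLemma u v s-prime s∣uv
  ... | inj₁ s∣u = s∤u s∣u
  ... | inj₂ s∣v = s∤v s∣v

  prime∤^ : ∀ {r} → Prime r → s ≢ r → ∀ e → s ∤ r ^ e
  prime∤^     r-prime s≢r zero    = prime∤1
  prime∤^ {r} r-prime s≢r (suc e) = prime∤* s∤r (prime∤^ r-prime s≢r e)
    where
    s∤r : s ∤ r
    s∤r s∣r with prime⇒irreducible r-prime s∣r
    ... | inj₁ refl = ¬prime[1] s-prime
    ... | inj₂ s≡r  = s≢r s≡r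

  prime-power-∣ : ∀ e {u c} → s ∤ u → s ^ e ∣ u ℕ.* c → s ^ e ∣ c
  prime-power-∣ zero    s∤u _ = ℕ∣.1∣ _
  prime-power-∣ (suc e) {u} {c} s∤u s^∣ with euclidsLemma u c s-prime (ℕ∣.∣-trans (ℕ∣.m∣m*n (s ^ e)) s^∣)
  ... | inj₁ s∣u = contradiction s∣u s∤u
  ... | inj₂ (divides k refl) = subst (s ^ suc e ∣_) (ℕ.*-comm s k) (ℕ∣.*-monoʳ-∣ s
          (prime-power-∣ e s∤u (ℕ∣.*-cancelˡ-∣ s (subst (s ^ suc e ∣_) (regroup u k s) s^∣))))
    where
    regroup : ∀ u k s → u ℕ.* (k ℕ.* s) ≡ s ℕ.* (u ℕ.* k)
    regroup = ℕSolver.solve-∀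

  -- The positive multiples of s below s² are k s with 0 < k < s, and each contains s exactly once;
  -- Legendre's formula stops after its first term.
  factorial-valuation : ∀ n → n ℕ.< s ℕ.* s → ∃ λ u → n ! ≡ s ^ (n / s) ℕ.* u × s ∤ u
  factorial-valuation zero    _     = 1 , cong (λ e → s ^ e ℕ.* 1) (sym (ℕ/.0/n≡0 s)) , prime∤1
  factorial-valuation (suc n) n<s² with factorial-valuation n (ℕ.<⇒≤ n<s²) | s ℕ∣.∣? suc n
  ... | u , n!≡ , s∤u | no s∤n = suc n ℕ.* u , eq , prime∤* s∤n s∤u
    where
    open ≡-Reasoning
    regroup : ∀ x y z → x ℕ.* (y ℕ.* z) ≡ y ℕ.* (x ℕ.* z)
    regroup = ℕSolver.solve-∀
    e = suc n / s
    e*s≤n : e ℕ.* s ℕ.≤ n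
    e*s≤n = ℕ.s≤s⁻¹ (ℕ.≤∧≢⇒< (ℕ/.m/n*n≤m (suc n) s) λ eq → s∤n (divides e (sym eq)))
    quotient : n / s ≡ e
    quotient = ℕ.≤-antisym (ℕ/./-monoˡ-≤ s (ℕ.n≤1+n n)) (subst (ℕ._≤ n / s) (ℕ/.m*n/n≡m e s) (ℕ/./-monoˡ-≤ s e*s≤n))
    eq : suc n ℕ.* n ! ≡ s ^ e ℕ.* (suc n ℕ.* u)
    eq = begin
      suc n ℕ.* n !                    ≡⟨ cong (suc n ℕ.*_) n!≡ ⟩
      suc n ℕ.* (s ^ (n / s) ℕ.* u)    ≡⟨ regroup (suc n) (s ^ (n / s)) u ⟩
      s ^ (n / s) ℕ.* (suc n ℕ.* u)    ≡⟨ cong (λ e → s ^ e ℕ.* (suc n ℕ.* u)) quotient ⟩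
      s ^ e ℕ.* (suc n ℕ.* u)          ∎
  ... | u , n!≡ , s∤u | yes (divides (suc k) n≡) = suc k ℕ.* u , eq , prime∤* s∤k s∤u
    where
    open ≡-Reasoning
    regroup : ∀ x y z s → (x ℕ.* s) ℕ.* (y ℕ.* z) ≡ (s ℕ.* y) ℕ.* (x ℕ.* z)
    regroup = ℕSolver.solve-∀
    s∤k : s ∤ suc k
    s∤k s∣k = ℕ.<⇒≱ (ℕ.*-cancelʳ-< s (suc k) s (subst (ℕ._< s ℕ.* s) n≡ n<s²)) (ℕ∣.∣⇒≤ s∣k)
    quotient : n / s ≡ k
    quotient = ℕ.≤-antisym (ℕ.s≤s⁻¹ (ℕ/.m<n*o⇒m/o<n {n = suc k} (ℕ.≤-reflexive n≡)))
      (subst (ℕ._≤ n / s) (ℕ/.m*n/n≡m k s) (ℕ/./-monoˡ-≤ s (ℕ.s≤s⁻¹ (ℕ.≤-trans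
        (ℕ.+-monoˡ-≤ (k ℕ.* s) (ℕ.>-nonZero⁻¹ s)) (ℕ.≤-reflexive (sym n≡))))))
    eq : suc n ℕ.* n ! ≡ s ^ (suc n / s) ℕ.* (suc k ℕ.* u)
    eq = begin
      suc n ℕ.* n !                            ≡⟨ cong₂ ℕ._*_ n≡ (trans n!≡ (cong (λ e → s ^ e ℕ.* u) quotient)) ⟩
      (suc k ℕ.* s) ℕ.* (s ^ k ℕ.* u)          ≡⟨ regroup (suc k) (s ^ k) u s ⟩
      s ^ suc k ℕ.* (suc k ℕ.* u)              ≡⟨ cong (λ e → s ^ e ℕ.* (suc k ℕ.* u)) (trans (cong (_/ s) n≡) (ℕ/.m*n/n≡m (suc k) s)) ⟨
      s ^ (suc n / s) ℕ.* (suc k ℕ.* u)        ∎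

  factorials-valuation : ∀ as → All (ℕ._< s ℕ.* s) as →
    ∃ λ u → product (map _! as) ≡ s ^ sum (map (_/ s) as) ℕ.* u × s ∤ u
  factorials-valuation []       []            = 1 , refl , prime∤1
  factorials-valuation (a ∷ as) (a<s² ∷ as<s²) with factorial-valuation a a<s² | factorials-valuation as as<s²
  ... | u , a!≡ , s∤u | v , as!≡ , s∤v = u ℕ.* v , eq , prime∤* s∤u s∤v
    where
    regroup : ∀ x u y v → (x ℕ.* u) ℕ.* (y ℕ.* v) ≡ (x ℕ.* y) ℕ.* (u ℕ.* v)
    regroup = ℕSolver.solve-∀
    eq = trans (cong₂ ℕ._*_ a!≡ as!≡) (trans (regroup (s ^ (a / s)) u (s ^ sum (map (_/ s) as)) v)
           (cong (ℕ._* (u ℕ.* v)) (sym (ℕ.^-distribˡ-+-* s (a / s) (sum (map (_/ s) as))))))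

  -- After cancelling the common power s^(x + b), the surplus s^(y - x) divides u c, hence c. For x
  -- > y the truncated difference makes the claim trivial.
  valuation-gap : ∀ b x y {u v c d} → s ∤ u → (s ^ (x ℕ.+ b) ℕ.* u) ℕ.* c ≡ (s ^ (y ℕ.+ b) ℕ.* v) ℕ.* d → s ^ (y ℕ.∸ x) ∣ c
  valuation-gap b x y {u} {v} {c} {d} s∤u eq with x ℕ.≤? y
  ... | no  x≰y = subst (λ e → s ^ e ∣ c) (sym (ℕ.m≤n⇒m∸n≡0 (ℕ.<⇒≤ (ℕ.≰⇒> x≰y)))) (ℕ∣.1∣ c)
  ... | yes x≤y = prime-power-∣ (y ℕ.∸ x) s∤u (divides (v ℕ.* d) (ℕ.*-cancelˡ-≡ (u ℕ.* c) _ (s ^ (x ℕ.+ b)) {{ℕ.m^n≢0 s (x ℕ.+ b)}} (begin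
      s ^ (x ℕ.+ b) ℕ.* (u ℕ.* c)                      ≡⟨ ℕ.*-assoc (s ^ (x ℕ.+ b)) u c ⟨
      (s ^ (x ℕ.+ b) ℕ.* u) ℕ.* c                      ≡⟨ eq ⟩
      (s ^ (y ℕ.+ b) ℕ.* v) ℕ.* d                      ≡⟨ cong (λ e → (s ^ e ℕ.* v) ℕ.* d) exponent ⟩
      (s ^ ((x ℕ.+ b) ℕ.+ (y ℕ.∸ x)) ℕ.* v) ℕ.* d       ≡⟨ cong (λ z → (z ℕ.* v) ℕ.* d) (ℕ.^-distribˡ-+-* s (x ℕ.+ b) (y ℕ.∸ x)) ⟩
      ((s ^ (x ℕ.+ b) ℕ.* s ^ (y ℕ.∸ x)) ℕ.* v) ℕ.* d   ≡⟨ regroup (s ^ (x ℕ.+ b)) (s ^ (y ℕ.∸ x)) v d ⟩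
      s ^ (x ℕ.+ b) ℕ.* ((v ℕ.* d) ℕ.* s ^ (y ℕ.∸ x))   ∎)))
    where
    open ≡-Reasoning
    regroup : ∀ g h v d → ((g ℕ.* h) ℕ.* v) ℕ.* d ≡ g ℕ.* ((v ℕ.* d) ℕ.* h)
    regroup = ℕSolver.solve-∀
    regroup₂ : ∀ x b z → (x ℕ.+ z) ℕ.+ b ≡ (x ℕ.+ b) ℕ.+ z
    regroup₂ = ℕSolver.solve-∀
    exponent : y ℕ.+ b ≡ (x ℕ.+ b) ℕ.+ (y ℕ.∸ x)
    exponent = trans (cong (ℕ._+ b) (sym (ℕ.m+[n∸m]≡n x≤y))) (regroup₂ x b (y ℕ.∸ x))

-- Once the first prime power is divided out of c, the others still divide the quotient, because
-- distinct primes do not divide each other's powers.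
prime-powers-∣ : ∀ (e : ℕ → ℕ) xs {c} → Unique xs → All (λ s → Prime (suc s)) xs → All (λ s → suc s ^ e s ∣ c) xs →
  product (map (λ s → suc s ^ e s) xs) ∣ c
prime-powers-∣ e []       _             _                []                     = ℕ∣.1∣ _
prime-powers-∣ e (x ∷ xs) (x≢ ∷ unique) (x-prime ∷ prime) (divides c refl ∷ div) = subst (product (map (λ s → suc s ^ e s) (x ∷ xs)) ∣_)
  (ℕ.*-comm (suc x ^ e x) c) (ℕ∣.*-monoʳ-∣ (suc x ^ e x) (prime-powers-∣ e xs unique prime (rest x≢ prime div)))
  where
  rest : ∀ {ys} → All (x ≢_) ys → All (λ s → Prime (suc s)) ys → All (λ s → suc s ^ e s ∣ c ℕ.* suc x ^ e x) ys → All (λ s → suc s ^ e s ∣ c) ys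
  rest []           []                 []        = []
  rest (x≢y ∷ x≢) (y-prime ∷ prime) (_∷_ {y} y∣ div) =
    prime-power-∣ y-prime (e y) (prime∤^ y-prime x-prime (λ eq → x≢y (sym (ℕ.suc-injective eq))) (e x)) (subst (suc y ^ e y ∣_) (ℕ.*-comm c (suc x ^ e x)) y∣)
      ∷ rest x≢ prime div

-- Exchanging the parameters q

AllPairs-head-max : ∀ {xs x} → AllPairs ℕ._≥_ xs → x ∈ xs → x ℕ.≤ nth xs 0
AllPairs-head-max (x≥ ∷ _) (here refl) = ℕ.≤-refl
AllPairs-head-max (x≥ ∷ _) (there y∈)  = All.lookup x≥ y∈

module _ {n : ℕ} (p q : Fin n → ℕ) (t : ℕ) where

  degrees : List (Fin n) → List (Fin n) → List ℕ
  degrees = zipWith (λ i j → p i ℕ.* t ℕ.+ q j ℕ.* t)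

  factorials : List (Fin n) → List (Fin n) → ℕ
  factorials is js = product (map _! (degrees is js))

  legState-params : legState (params n p q t) ≡ pairState n p q t (allFin n) (allFin n)
  legState-params = trans (sym (L.map-∘ (allFin n))) (sym (zipWith-diag _ (allFin n)))

  factorials-binoms : ∀ is js → length is ≡ length js → ∀ x →
    ℕ→ℚ (factorials is js) * binoms (pairState n p q t is js) x ≡
    prod (λ i → rising (p i ℕ.* t) x) is * prod (λ j → falling (q j ℕ.* t) x) js
  factorials-binoms []       []       _   x = refl
  factorials-binoms (i ∷ is) (j ∷ js) len x = begin
    ℕ→ℚ (a ! ℕ.* w) * (b * bs)                            ≡⟨ cong (_* (b * bs)) (ℕ→ℚ-* (a !) w) ⟩
    ℕ→ℚ (a !) * ℕ→ℚ w * (b * bs)                          ≡⟨ solve 4 (λ a w b c → a :* w :* (b :* c) := (a :* b) :* (w :* c)) refl (ℕ→ℚ (a !)) (ℕ→ℚ w) b bs ⟩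
    ℕ→ℚ (a !) * b * (ℕ→ℚ w * bs)                          ≡⟨ cong₂ _*_ (factorial-binom (p i ℕ.* t) (q j ℕ.* t) x) (factorials-binoms is js (ℕ.suc-injective len) x) ⟩
    r * f * (rs * fs)                                     ≡⟨ solve 4 (λ r f x y → r :* f :* (x :* y) := (r :* x) :* (f :* y)) refl r f rs fs ⟩
    (r * rs) * (f * fs)                                   ∎
    where
    open ≡-Reasoning
    a = p i ℕ.* t ℕ.+ q j ℕ.* t
    w = factorials is js
    b = binom (p i ℕ.* t) a x
    bs = binoms (pairState n p q t is js) x
    r = rising (p i ℕ.* t) x
    f = falling (q j ℕ.* t) x
    rs = prod (λ i → rising (p i ℕ.* t) x) is
    fs = prod (λ j → falling (q j ℕ.* t) x) js

  factorials-binoms-↭ : ∀ {is js js′} → length is ≡ length js → js ↭ js′ →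
    ℕ→ℚ (factorials is js) • binoms (pairState n p q t is js) ≗ ℕ→ℚ (factorials is js′) • binoms (pairState n p q t is js′)
  factorials-binoms-↭ {is} {js} {js′} len js↭js′ x = trans (factorials-binoms is js len x)
    (trans (cong (prod (λ i → rising (p i ℕ.* t) x) is *_) (prod-↭ (λ j → falling (q j ℕ.* t) x) js↭js′))
      (sym (factorials-binoms is js′ (trans len (↭-length js↭js′)) x)))

  entry≤K₁ : ∀ i j → p i ℕ.+ q j ℕ.≤ K n p q 1
  entry≤K₁ i j = AllPairs-head-max (Klist-sorted n p q) (∈-resp-↭ (↭-sym (Klist-↭ n p q))
    (∈-concatMap⁺ _ {xs = allFin n} (Any.map (λ { refl → ∈-map⁺ _ (∈-allFin j) }) (∈-allFin i))))

  module _ (s : ℕ) .{{_ : NonZero s}} where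

    fractions : List (Fin n) → List (Fin n) → ℕ
    fractions is js = sum (zipWith (λ i j → floorAω t s (p i ℕ.+ q j)) is js)

    integral : List (Fin n) → List (Fin n) → ℕ
    integral is js = sum (map (λ i → p i ℕ.* (t / s)) is) ℕ.+ sum (map (λ j → q j ℕ.* (t / s)) js)

    -- Writing t = (t mod s) + s ⌊t / s⌋ splits off an integer that is additive in p i and q j, so
    -- its sum does not depend on the pairing. Only the fractional part, which `μ` measures, does.
    floor-split : ∀ i j → (p i ℕ.* t ℕ.+ q j ℕ.* t) / s ≡ floorAω t s (p i ℕ.+ q j) ℕ.+ (p i ℕ.* (t / s) ℕ.+ q j ℕ.* (t / s))
    floor-split i j = begin
      (p i ℕ.* t ℕ.+ q j ℕ.* t) / s                   ≡⟨ cong (_/ s) (ℕ.*-distribʳ-+ t (p i) (q j)) ⟨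
      a ℕ.* t / s                                     ≡⟨ cong (λ t → a ℕ.* t / s) (ℕ/.m≡m%n+[m/n]*n t s) ⟩
      a ℕ.* (t % s ℕ.+ t / s ℕ.* s) / s               ≡⟨ cong (_/ s) (regroup a (t % s) (t / s) s) ⟩
      (a ℕ.* (t % s) ℕ.+ a ℕ.* (t / s) ℕ.* s) / s     ≡⟨ ℕ/.+-distrib-/-∣ʳ (a ℕ.* (t % s)) (divides (a ℕ.* (t / s)) refl) ⟩
      a ℕ.* (t % s) / s ℕ.+ a ℕ.* (t / s) ℕ.* s / s   ≡⟨ cong (floorAω t s a ℕ.+_) (ℕ/.m*n/n≡m (a ℕ.* (t / s)) s) ⟩
      floorAω t s a ℕ.+ a ℕ.* (t / s)                 ≡⟨ cong (floorAω t s a ℕ.+_) (ℕ.*-distribʳ-+ (t / s) (p i) (q j)) ⟩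
      floorAω t s a ℕ.+ (p i ℕ.* (t / s) ℕ.+ q j ℕ.* (t / s)) ∎
      where
      open ≡-Reasoning
      a = p i ℕ.+ q j
      regroup : ∀ a r k s → a ℕ.* (r ℕ.+ k ℕ.* s) ≡ a ℕ.* r ℕ.+ a ℕ.* k ℕ.* s
      regroup = ℕSolver.solve-∀

    floors-split : ∀ is js → length is ≡ length js → sum (map (_/ s) (degrees is js)) ≡ fractions is js ℕ.+ integral is js
    floors-split []       []       _   = refl
    floors-split (i ∷ is) (j ∷ js) len = trans (cong₂ ℕ._+_ (floor-split i j) (floors-split is js (ℕ.suc-injective len)))
      (regroup (floorAω t s (p i ℕ.+ q j)) (p i ℕ.* (t / s)) (q j ℕ.* (t / s)) (fractions is js) _ _)
      where
      regroup : ∀ a x y b z w → (a ℕ.+ (x ℕ.+ y)) ℕ.+ (b ℕ.+ (z ℕ.+ w)) ≡ (a ℕ.+ b) ℕ.+ ((x ℕ.+ z) ℕ.+ (y ℕ.+ w))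
      regroup = ℕSolver.solve-∀

    integral-↭ : ∀ is {js js′} → js ↭ js′ → integral is js ≡ integral is js′
    integral-↭ is js↭js′ = cong (sum (map (λ i → p i ℕ.* (t / s)) is) ℕ.+_) (sum-↭ (map⁺ _ js↭js′))

    μ-attained : μ n p q t s ≡ 0 ⊎
      ∃ λ σ → σ ↭ allFin n × μ n p q t s ≡ fractions (allFin n) σ ℕ.∸ fractions (allFin n) (allFin n)
    μ-attained with foldr-⊔-∈ (map (fractions (allFin n)) (perms (allFin n)))
    -- The value 0 may be the default of the fold instead of an attained value; `μ` is 0 in either
    -- case.
    ... | inj₁ max≡0 = inj₁ (trans (cong (ℕ._∸ base) max≡0) (ℕ.0∸n≡0 base))
      where base = sum (map (λ i → floorAω t s (p i ℕ.+ q i)) (allFin n))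
    ... | inj₂ max∈ with ∈-map⁻ (fractions (allFin n)) max∈
    ... | σ , σ∈ , max≡ = inj₂ (σ , perms-↭ (allFin n) σ∈ , cong₂ ℕ._∸_ max≡ (cong sum (sym (zipWith-diag _ (allFin n)))))

  degrees< : ∀ {b} → K n p q 1 ℕ.* t ℕ.< b → ∀ is js → All (ℕ._< b) (degrees is js)
  degrees< K₁t<b []       js       = []
  degrees< K₁t<b (i ∷ is) []       = []
  degrees< K₁t<b (i ∷ is) (j ∷ js) = ℕ.≤-<-trans
    (subst (ℕ._≤ K n p q 1 ℕ.* t) (ℕ.*-distribʳ-+ t (p i) (q j)) (ℕ.*-monoˡ-≤ t (entry≤K₁ i j))) K₁t<b ∷ degrees< K₁t<b is js

  -- z is the corresponding coefficient for the parameters p i and q (σ i).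
  IntAfterExchange : ℚ → List (Fin n) → Set
  IntAfterExchange x σ = ∃ λ z → ℕ→ℚ (factorials (allFin n) (allFin n)) * x ≡ ℕ→ℚ (factorials (allFin n) σ) * ℤ→ℚ z

  -- Linearity carries `factorials-binoms-↭` through the iterate of T. The same `dprod` serves every
  -- σ, since `Klist` contains all sums p i + q j.
  coef-exchange : ∀ {m} → m ℕ.≤ n → ∀ N {σ} → σ ↭ allFin n →
    IntAfterExchange (coef (scale (ℕ→ℚ (dprod n p q t m)) (iterate m T (MultiLegendre (params n p q t)))) N) σ
  coef-exchange {m} m≤n N {σ} σ↭ = proj₁ int , (begin
    w * coef (scale d (iterate m T ML)) N             ≡⟨ cong (w *_) (trans (coef-scale d (iterate m T ML) N) (cong (d *_) (trans
                                                           (coef-iterate-T m ML (ℕ.m≤m⊔n (length ML) (size sσ)) N)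
                                                           (respect (^∘-linear (Tₛ-linear B) m) ML≗ N)))) ⟩
    w * (d * op (binoms s₁) N)                        ≡⟨ solve 3 (λ w d x → w :* (d :* x) := d :* (w :* x)) refl w d (op (binoms s₁) N) ⟩
    d * (w * op (binoms s₁) N)                        ≡⟨ cong (d *_) (trans (sym (scal op-linear w (binoms s₁) N)) (trans
                                                           (respect op-linear (factorials-binoms-↭ {allFin n} refl (↭-sym σ↭)) N)
                                                           (scal op-linear wσ (binoms sσ) N))) ⟩
    d * (wσ * op (binoms sσ) N)                       ≡⟨ solve 3 (λ w d x → d :* (w :* x) := w :* (d :* x)) refl wσ d (op (binoms sσ) N) ⟩
    wσ * (d * op (binoms sσ) N)                       ≡⟨ cong (wσ *_) (proj₂ int) ⟩
    wσ * ℤ→ℚ (proj₁ int)                              ∎)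
    where
    open ≡-Reasoning
    d = ℕ→ℚ (dprod n p q t m)
    ML = MultiLegendre (params n p q t)
    s₁ = pairState n p q t (allFin n) (allFin n)
    sσ = pairState n p q t (allFin n) σ
    -- Large enough for the truncation to agree with `T` on the original polynomial and for the
    -- degree bound of the permuted state.
    B = length ML ℕ.⊔ size sσ
    w = ℕ→ℚ (factorials (allFin n) (allFin n))
    wσ = ℕ→ℚ (factorials (allFin n) σ)
    op : Seq → Seq
    op r = (Tₛ B ^∘ m) (α r)
    op-linear = ∘-linear (^∘-linear (Tₛ-linear B) m) α-linear
    ML≗ : coef ML ≗ α (binoms s₁)
    ML≗ i = trans (coef-MultiLegendre (params n p q t) i) (cong (λ s → α (binoms s) i) legState-params)
    int : IsInt (d * op (binoms sσ) N)
    int = T-binoms-int m (dprod n p q t m) sσ (ℕ.m≤n⊔m (length ML) (size sσ)) (Moves-∣-dprod n p q t m≤n σ) N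

  module _ {x : ℚ} (exchange : ∀ {σ} → σ ↭ allFin n → IntAfterExchange x σ) where

    -- For the identity permutation the two factorial products coincide, and being nonzero they
    -- cancel.
    exchange⇒IsInt : IsInt x
    exchange⇒IsInt = cancel (factorials (allFin n) (allFin n)) (factorials-nonZero (degrees (allFin n) (allFin n))) (exchange ↭-refl)
      where
      factorials-nonZero : ∀ as → NonZero (product (map _! as))
      factorials-nonZero []       = _
      factorials-nonZero (a ∷ as) = ℕ.m*n≢0 (a !) (product (map _! as)) {{a ℕ.!≢0}} {{factorials-nonZero as}}
      cancel : ∀ w → NonZero w → (∃ λ z → ℕ→ℚ w * x ≡ ℕ→ℚ w * ℤ→ℚ z) → IsInt x
      cancel (suc w) _ (z , eq) = z , ℕ→ℚ-cancelˡ w eq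

    -- For a σ that attains `μ`, the exchange identity is read in ℕ by taking absolute values. The
    -- power of the prime that the right-hand factorials have in excess must come from c.
    prime-power-∣-exchange : ∀ c → x ≡ ℤ→ℚ c → ∀ {s} (s-prime : Prime (suc s)) → K n p q 1 ℕ.* t ℕ.< suc s ℕ.* suc s →
      suc s ^ μ n p q t (suc s) ∣ ℤ.∣ c ∣
    prime-power-∣-exchange c x≡c {s} s-prime K₁t<s² = by-cases (μ-attained (suc s))
      where
      w = factorials (allFin n) (allFin n)
      absolute : ∀ wσ c′ → ℕ→ℚ w * x ≡ ℕ→ℚ wσ * ℤ→ℚ c′ → w ℕ.* ℤ.∣ c ∣ ≡ wσ ℕ.* ℤ.∣ c′ ∣
      absolute wσ c′ eq = trans (sym (ℤ.abs-* (ℤ.+ w) c)) (trans (cong ℤ.∣_∣ (ℤ→ℚ-injective {ℤ.+ w ℤ.* c} {ℤ.+ wσ ℤ.* c′} (trans (ℤ→ℚ-* (ℤ.+ w) c)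
        (trans (cong (ℕ→ℚ w *_) (sym x≡c)) (trans eq (sym (ℤ→ℚ-* (ℤ.+ wσ) c′))))))) (ℤ.abs-* (ℤ.+ wσ) c′))
      valuation : ∀ {σ} → σ ↭ allFin n → ∃ λ u → factorials (allFin n) σ ≡
        suc s ^ (fractions (suc s) (allFin n) σ ℕ.+ integral (suc s) (allFin n) (allFin n)) ℕ.* u × suc s ∤ u
      valuation {σ} σ↭ = proj₁ val , trans (proj₁ (proj₂ val)) (cong (λ e → suc s ^ e ℕ.* proj₁ val)
        (trans (floors-split (suc s) (allFin n) σ (sym (↭-length σ↭)))
          (cong (fractions (suc s) (allFin n) σ ℕ.+_) (integral-↭ (suc s) (allFin n) σ↭)))) , proj₂ (proj₂ val)
        where val = factorials-valuation s-prime (degrees (allFin n) σ) (degrees< K₁t<s² (allFin n) σ)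
      gap : ∀ {σ} → σ ↭ allFin n → suc s ^ (fractions (suc s) (allFin n) σ ℕ.∸ fractions (suc s) (allFin n) (allFin n)) ∣ ℤ.∣ c ∣
      gap {σ} σ↭ = valuation-gap s-prime (integral (suc s) (allFin n) (allFin n)) (fractions (suc s) (allFin n) (allFin n)) (fractions (suc s) (allFin n) σ)
        (proj₂ (proj₂ (valuation ↭-refl)))
        (subst₂ (λ y z → y ℕ.* ℤ.∣ c ∣ ≡ z ℕ.* ℤ.∣ proj₁ (exchange σ↭) ∣)
          (proj₁ (proj₂ (valuation ↭-refl))) (proj₁ (proj₂ (valuation σ↭))) (absolute (factorials (allFin n) σ) (proj₁ (exchange σ↭)) (proj₂ (exchange σ↭))))
      by-cases : (μ n p q t (suc s) ≡ 0 ⊎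
        ∃ λ σ → σ ↭ allFin n × μ n p q t (suc s) ≡ fractions (suc s) (allFin n) σ ℕ.∸ fractions (suc s) (allFin n) (allFin n)) →
        suc s ^ μ n p q t (suc s) ∣ ℤ.∣ c ∣
      by-cases (inj₁ μ≡0)            = subst (λ e → suc s ^ e ∣ ℤ.∣ c ∣) (sym μ≡0) (ℕ∣.1∣ ℤ.∣ c ∣)
      by-cases (inj₂ (σ , σ↭ , μ≡)) = subst (λ e → suc s ^ e ∣ ℤ.∣ c ∣) (sym μ≡) (gap σ↭)

    exchange⇒DivIntBy : DivIntBy (Δ n p q t) x
    exchange⇒DivIntBy = signed (ℤ∣.∣ᵤ⇒∣ {ℤ.+ Δ n p q t} {c} Δ∣c)
      where
      c = proj₁ exchange⇒IsInt
      large? = λ s → prime? (suc s) ×-dec (K n p q 1 ℕ.* t ℕ.<? suc s ℕ.* suc s)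
      large = all-filter large? (upTo (K n p q 1 ℕ.* t))
      Δ∣c : Δ n p q t ∣ ℤ.∣ c ∣
      Δ∣c = prime-powers-∣ (λ s → μ n p q t (suc s)) (filter large? (upTo (K n p q 1 ℕ.* t)))
        (Unique.filter⁺ large? (Unique.upTo⁺ (K n p q 1 ℕ.* t)))
        (All.map proj₁ large)
        (All.map (λ (s-prime , K₁t<s²) → prime-power-∣-exchange c (proj₂ exchange⇒IsInt) s-prime K₁t<s²) large)
      signed : ℤ.+ Δ n p q t ℤ∣.∣ c → DivIntBy (Δ n p q t) x
      signed (ℤ∣.divides k eq) = k , trans (proj₂ exchange⇒IsInt) (cong ℤ→ℚ eq)

-- From single coefficients to the polynomial

All-coef : ∀ {Q : ℚ → Set} P → (∀ n → Q (coef P n)) → All Q P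
All-coef []      q = []
All-coef (a ∷ P) q = q 0 ∷ All-coef P (q ∘ suc)

theorem6p1 : (n : ℕ) → 2 ≤ n → (m : ℕ) → 1 ≤ m → m ≤ n ∸ 1 →
    (p q : Fin n → ℕ) → (t : ℕ) →
    InDeltaZz (Δ n p q t)
    (scale (ℕ→ℚ (dprod n p q t m)) (iterate m T (MultiLegendre (params n p q t))))
theorem6p1 n _ m _ m≤n∸1 p q t = All-coef (scale (ℕ→ℚ (dprod n p q t m)) (iterate m T (MultiLegendre (params n p q t))))
  (λ N → exchange⇒DivIntBy p q t (coef-exchange p q t (ℕ.≤-trans m≤n∸1 (ℕ.m∸n≤m n 1)) N))
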